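{- Every graph $G$ with maximum degree $\Delta$ is $\lceil\frac{2}{5}(\Delta+1)\rceil$-choosable with clustering $6$.
   Context: Graphs are finite and simple. In a coloured graph the monochromatic subgraph is the spanning subgraph of edges whose endpoints have the same colour; its connected components are monochromatic components. A colouring has clustering $c$ if every monochromatic component has at most $c$ vertices. A $k$-list-assignment $L$ assigns to each vertex $v$ a set $L(v)$ of at least $k$ colours; an $L$-colouring colours each $v$ with a colour from $L(v)$. $G$ is $k$-choosable with clustering $c$ if for every $k$-list-assignment $L$, $G$ has an $L$-colouring with clustering $c$. -}

module Defs where

open import Data.Nat using (ℕ; suc; _+_; _*_; _≤_; _/_)
open import Data.Fin using (Fin)
open import Data.Bool using (Bool; true; false; T)
open import Data.List using (List; length; filterᵇ; allFin)
open import Data.List.Membership.Propositional using (_∈_)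
open import Data.List.Relation.Unary.All using (All)
open import Data.List.Relation.Unary.Unique.Propositional using (Unique)
open import Data.Product using (_×_; ∃)
open import Relation.Binary.PropositionalEquality using (_≡_)
open import Relation.Binary.Construct.Closure.ReflexiveTransitive using (Star)

record Graph : Set where
  field
    n     : ℕ
    adj   : Fin n → Fin n → Bool
    sym   : ∀ u v → adj u v ≡ adj v u
    irrefl : ∀ v → adj v v ≡ false

open Graph public

degree : (G : Graph) → Fin (n G) → ℕ
degree G v = length (filterᵇ (adj G v) (allFin (n G)))

MaxDegree≤ : Graph → ℕ → Set
MaxDegree≤ G Δ = ∀ v → degree G v ≤ Δ

⌈_/5⌉ : ℕ → ℕ
⌈ a /5⌉ = (a + 4) / 5

IsKListAssignment : (G : Graph) → (k : ℕ) → (Fin (n G) → List ℕ) → Set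
IsKListAssignment G k L = ∀ v → Unique (L v) × k ≤ length (L v)

IsLColouring : (G : Graph) → (Fin (n G) → List ℕ) → (Fin (n G) → ℕ) → Set
IsLColouring G L f = ∀ v → f v ∈ L v

MonoEdge : (G : Graph) → (Fin (n G) → ℕ) → Fin (n G) → Fin (n G) → Set
MonoEdge G f u v = T (adj G u v) × f u ≡ f v

SameMonoComponent : (G : Graph) → (Fin (n G) → ℕ) → Fin (n G) → Fin (n G) → Set
SameMonoComponent G f = Star (MonoEdge G f)

-- clustering c: the monochromatic component of every vertex v has at most c
-- vertices, i.e. any list of distinct vertices in v's component has length ≤ c
HasClustering : (G : Graph) → (Fin (n G) → ℕ) → ℕ → Set
HasClustering G f c =
  ∀ (v : Fin (n G)) (us : List (Fin (n G))) →
    Unique us → All (SameMonoComponent G f v) us → length us ≤ c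

ChoosableWithClustering : Graph → ℕ → ℕ → Set
ChoosableWithClustering G k c =
  ∀ (L : Fin (n G) → List ℕ) → IsKListAssignment G k L →
    ∃ λ (f : Fin (n G) → ℕ) → IsLColouring G L f × HasClustering G f c

{-# OPTIONS --safe #-}
module Submission where

-- Choose an L-colouring f with the fewest monochromatic edges and then a set S of pairwise
-- non-adjacent vertices of monochromatic degree 2 (non-adjacent in the monochromatic subgraph),
-- as large as possible over all such f. All monochromatic degrees are at most 2. A pigeonhole
-- argument, which needs the factor 2/5, gives every s in S a second colour c s such that after
-- changing any subset of S from f to c the number of monochromatic edges is still minimal, and
-- hence all degrees are still at most 2. Maximality of S makes the monochromatic components of
-- V ∖ S ("nodes") have at most 2 vertices. In either of its two colours a vertex of S joins two
-- nodes, and since all degrees stay at most 2 a node is joined at most twice, counting both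
-- colours of all vertices of S. So the literals "s has colour f s", "s has colour c s" lie on
-- disjoint paths and cycles, consecutive ones sharing a node. There is an assignment without
-- three consecutive true literals. Then a component consists of at most three nodes and two
-- vertices of S; two nodes of size 2 in it would allow a larger S, so it has at most
-- 2 + 1 + 1 + 2 vertices.

open import Defs
open import Data.Nat using (ℕ; zero; suc; _+_; _*_; _∸_; _/_; _%_; _≤_; _<_; _≟_; _≤?_; z≤n; s≤s; s≤s⁻¹)
open import Data.Nat.DivMod using (m≡m%n+[m/n]*n; m%n<n)
open import Data.Nat.ListAction using () renaming (sum to sumₗ)
open import Data.Nat.Properties
open import Data.Bool using (Bool; true; false; not; _∧_; _xor_; if_then_else_)
open import Data.Bool.Properties using (∧-identityʳ; ∧-zeroʳ; ¬-not; not-¬; not-involutive; xor-identityʳ; T-≡) renaming (_≟_ to _≟B_)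
open import Data.Empty using (⊥; ⊥-elim)
open import Data.Fin using (Fin; zero; suc)
open import Data.Fin.Properties using (all?) renaming (_≟_ to _≟F_; any? to anyF?; suc-injective to sucF-injective)
open import Data.List using (List; []; _∷_; _++_; length; map; filter; filterᵇ; tabulate; allFin; cartesianProduct; cartesianProductWith)
open import Data.List.Extrema ≤-totalOrder using (argmin; argmin-all; f[argmin]≤f[xs])
open import Data.List.Membership.DecPropositional _≟_ using (_∈?_)
open import Data.List.Membership.Propositional using (_∈_; find; lose)
open import Data.List.Membership.Propositional.Properties using (∈-cartesianProduct⁺; ∈-cartesianProductWith⁺; ∈-filter⁺; ∈-allFin; ∈-++⁺ˡ; ∈-++⁺ʳ; ∈-++⁻; ∈-∃++)
open import Data.List.Properties using (length-++)
open import Data.List.Relation.Unary.All using (All; []; _∷_; lookup)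
open import Data.List.Relation.Unary.All.Properties using (All¬⇒¬Any; all-filter)
open import Data.List.Relation.Unary.AllPairs using ([]; _∷_)
open import Data.List.Relation.Unary.Any using (here; there; any?)
open import Data.List.Relation.Unary.Unique.Propositional using (Unique)
open import Data.Maybe using (Maybe; just; nothing) renaming (map to mapMaybe)
open import Data.Maybe.Properties using (just-injective)
open import Data.Product using (_×_; _,_; ∃; ∃₂; proj₁; proj₂)
open import Data.Product.Properties using (≡-dec)
open import Data.Sum using (_⊎_; inj₁; inj₂)
open import Data.Vec.Functional using (updateAt) renaming (_∷_ to _∷ᶠ_)
open import Data.Vec.Functional.Properties using (updateAt-updates; updateAt-minimal)
open import Algebra.Properties.CommutativeMonoid.Sum +-0-commutativeMonoid using (sum; sum-cong-≗; ∑-distrib-+)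
open import Algebra.Properties.CommutativeSemigroup +-commutativeSemigroup using () renaming (interchange to +-interchange)
open import Function using (_∘_; const; id)
open import Function.Bundles using (Equivalence)
open import Relation.Binary using (DecidableEquality)
open import Relation.Binary.Construct.Closure.ReflexiveTransitive using (Star; ε; _◅_)
open import Relation.Binary.PropositionalEquality using (_≡_; _≢_; _≗_; refl; cong; cong₂; subst; trans; module ≡-Reasoning) renaming (sym to ≡-sym)
open import Relation.Nullary using (¬_; Dec; yes; no; does; contradiction; ¬?)
open import Relation.Nullary.Decidable using (_×-dec_; _⊎-dec_; _→-dec_; dec-true; dec-false; map′)

-- Finite sets as Boolean predicates, and their cardinalities.

[_] : Bool → ℕ
[ true ]  = 1
[ false ] = 0

sum-mono : ∀ {m} {p q : Fin m → ℕ} → (∀ i → p i ≤ q i) → sum p ≤ sum q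
sum-mono {zero}  le = z≤n
sum-mono {suc m} le = +-mono-≤ (le zero) (sum-mono (le ∘ suc))

card : ∀ {m} → (Fin m → Bool) → ℕ
card p = sum ([_] ∘ p)

card-cong : ∀ {m} {p q : Fin m → Bool} → p ≗ q → card p ≡ card q
card-cong eq = sum-cong-≗ (cong [_] ∘ eq)

card-mono : ∀ {m} {p q : Fin m → Bool} → (∀ i → p i ≡ true → q i ≡ true) → card p ≤ card q
card-mono {p = p} {q} imp = sum-mono pointwise
  where
  pointwise : ∀ i → [ p i ] ≤ [ q i ]
  pointwise i with p i in eq
  ... | false = z≤n
  ... | true rewrite imp i eq = ≤-refl

card≤ : ∀ {m} (p : Fin m → Bool) → card p ≤ m
card≤ {zero}  p = z≤n
card≤ {suc m} p = +-mono-≤ (bit (p zero)) (card≤ (p ∘ suc))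
  where
  bit : ∀ b → [ b ] ≤ 1
  bit true  = ≤-refl
  bit false = z≤n

card-insert : ∀ {m} {p q : Fin m → Bool} a → p a ≡ false → q a ≡ true →
  (∀ i → i ≢ a → p i ≡ q i) → card q ≡ suc (card p)
card-insert {suc m} {p} {q} zero pa qa eq rewrite pa | qa =
  cong suc (card-cong {p = q ∘ suc} (λ i → ≡-sym (eq (suc i) λ ())))
card-insert {suc m} {p} {q} (suc a) pa qa eq = begin
  [ q zero ] + card (q ∘ suc)       ≡⟨ cong₂ _+_ (cong [_] (≡-sym (eq zero λ ()))) ih ⟩
  [ p zero ] + suc (card (p ∘ suc)) ≡⟨ +-suc [ p zero ] _ ⟩
  suc (card p)                      ∎
  where
  open ≡-Reasoning
  ih = card-insert {p = p ∘ suc} {q ∘ suc} a pa qa (λ i i≢a → eq (suc i) (i≢a ∘ sucF-injective))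

_∪｛_｝ _∖｛_｝ : ∀ {m} → (Fin m → Bool) → Fin m → Fin m → Bool
p ∪｛ a ｝ = updateAt p a (const true)
p ∖｛ a ｝ = updateAt p a (const false)

card-∪ : ∀ {m} (p : Fin m → Bool) a → p a ≡ false → card (p ∪｛ a ｝) ≡ suc (card p)
card-∪ p a pa =
  card-insert a pa (updateAt-updates a p) (λ i i≢a → ≡-sym (updateAt-minimal i a p i≢a))

card-∖ : ∀ {m} (p : Fin m → Bool) a → p a ≡ true → card p ≡ suc (card (p ∖｛ a ｝))
card-∖ p a pa = card-insert a (updateAt-updates a p) pa (λ i → updateAt-minimal i a p)

∖-⊆ : ∀ {m} (p : Fin m → Bool) {a i} → (p ∖｛ a ｝) i ≡ true → i ≢ a × p i ≡ true
∖-⊆ p {a} {i} eq with i ≟F a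
... | yes refl = contradiction (trans (≡-sym (updateAt-updates a p)) eq) λ ()
... | no i≢a   = i≢a , trans (≡-sym (updateAt-minimal i a p i≢a)) eq

card-strict : ∀ {m} {p q : Fin m → Bool} a → (∀ i → p i ≡ true → q i ≡ true) →
  p a ≡ false → q a ≡ true → suc (card p) ≤ card q
card-strict {p = p} {q} a imp pa qa =
  subst (suc (card p) ≤_) (≡-sym (card-∖ q a qa)) (s≤s (card-mono inside))
  where
  inside : ∀ i → p i ≡ true → (q ∖｛ a ｝) i ≡ true
  inside i pi = trans (updateAt-minimal i a q λ { refl → contradiction (trans (≡-sym pa) pi) λ () }) (imp i pi)

card≥1 : ∀ {m} (p : Fin m → Bool) {a} → p a ≡ true → 1 ≤ card p
card≥1 p {a} pa = subst (1 ≤_) (≡-sym (card-∖ p a pa)) (s≤s z≤n)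

card≥2 : ∀ {m} (p : Fin m → Bool) {a b} → a ≢ b → p a ≡ true → p b ≡ true → 2 ≤ card p
card≥2 p {a} {b} a≢b pa pb = subst (2 ≤_) (≡-sym (card-∖ p a pa))
  (s≤s (card≥1 (p ∖｛ a ｝) (trans (updateAt-minimal b a p (a≢b ∘ ≡-sym)) pb)))

card≥3 : ∀ {m} (p : Fin m → Bool) {a b c} → a ≢ b → a ≢ c → b ≢ c →
  p a ≡ true → p b ≡ true → p c ≡ true → 3 ≤ card p
card≥3 p {a} {b} {c} a≢b a≢c b≢c pa pb pc = subst (3 ≤_) (≡-sym (card-∖ p a pa))
  (s≤s (card≥2 (p ∖｛ a ｝) b≢c (trans (updateAt-minimal b a p (a≢b ∘ ≡-sym)) pb)
                                (trans (updateAt-minimal c a p (a≢c ∘ ≡-sym)) pc)))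

pick : ∀ {m} (p : Fin m → Bool) → 1 ≤ card p → ∃ λ a → p a ≡ true
pick {suc m} p le with p zero in eq
... | true  = zero , eq
... | false with pick (p ∘ suc) le
...   | a , pa = suc a , pa

pick₂ : ∀ {m} (p : Fin m → Bool) → 2 ≤ card p → ∃₂ λ a b → a ≢ b × p a ≡ true × p b ≡ true
pick₂ p le with pick p (≤-trans (s≤s z≤n) le)
... | a , pa with pick (p ∖｛ a ｝) (s≤s⁻¹ (subst (2 ≤_) (card-∖ p a pa) le))
...   | b , pb with ∖-⊆ p pb
...     | b≢a , pb′ = a , b , b≢a ∘ ≡-sym , pa , pb′

-- Minimising over functions with values in given finite lists.

module _ {A : Set} where

  choices : ∀ {m} → (Fin m → List A) → List (Fin m → A)
  choices {zero}  Ls = (λ ()) ∷ []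
  choices {suc m} Ls = cartesianProductWith _∷ᶠ_ (Ls zero) (choices (Ls ∘ suc))

  -- Functions are enumerated only up to `≗`, which is why `minimiser` asks `P` and `μ` to respect
  -- it.
  choices-complete : ∀ {m} {Ls : Fin m → List A} {h} → (∀ i → h i ∈ Ls i) → ∃ λ h′ → h′ ∈ choices Ls × h ≗ h′
  choices-complete {zero}  _ = (λ ()) , here refl , λ ()
  choices-complete {suc m} {h = h} h∈ with choices-complete (h∈ ∘ suc)
  ... | t , t∈ , h≗t = h zero ∷ᶠ t , ∈-cartesianProductWith⁺ _∷ᶠ_ (h∈ zero) t∈ , λ { zero → refl ; (suc i) → h≗t i }

  minimiser : ∀ {m} (Ls : Fin m → List A) {P : (Fin m → A) → Set} (P? : ∀ h → Dec (P h)) (μ : (Fin m → A) → ℕ) →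
    (∀ {h} → P h → ∀ i → h i ∈ Ls i) → (∀ {h h′} → h ≗ h′ → P h → P h′) → (∀ {h h′} → h ≗ h′ → μ h ≡ μ h′) →
    ∃ P → ∃ λ h → P h × (∀ {h′} → P h′ → μ h ≤ μ h′)
  minimiser Ls {P} P? μ within P-resp μ-resp (h₀ , P₀) =
    best , argmin-all μ P₀ (all-filter P? (choices Ls)) , least
    where
    candidates = filter P? (choices Ls)
    best = argmin μ h₀ candidates
    least : ∀ {h′} → P h′ → μ best ≤ μ h′
    least {h′} p with choices-complete (within p)
    ... | h″ , h″∈ , h′≗h″ = subst (μ best ≤_) (≡-sym (μ-resp h′≗h″))
            (lookup (f[argmin]≤f[xs] {f = μ} h₀ candidates) (∈-filter⁺ P? h″∈ (P-resp h′≗h″ p)))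

-- Consistent orientation of paths and cycles.

-- The two ends (darts) of every item and the pairs of β are two matchings, whose union is
-- bipartite. The induction removes an item x and joins the β-partners of its two darts.
module Orientation {A : Set} (_≟A_ : DecidableEquality A) where

  Dart : Set
  Dart = A × Bool

  -- The bipartition. Through `xor` the two darts of an item lie on opposite sides automatically, so
  -- `Orients` only has to speak of the pairs of `β`.
  side : (A → Bool) → Dart → Bool
  side o (x , i) = o x xor i

  xor-true : ∀ b → b xor true ≡ not b
  xor-true true  = refl
  xor-true false = refl

  record Matching (β : Dart → Maybe Dart) (xs : List A) : Set where
    field
      symmetric : ∀ {d e} → β d ≡ just e → β e ≡ just d
      irreflexive : ∀ {d} → β d ≢ just d
      within : ∀ {d e} → β d ≡ just e → proj₁ d ∈ xs
  open Matching

  module _ (β : Dart → Maybe Dart) (x : A) where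

    avoid : Dart → Maybe Dart
    avoid (y , j) with y ≟A x
    ... | yes _ = nothing
    ... | no _  = just (y , j)

    through : Dart → Maybe Dart
    through (y , j) with y ≟A x
    ... | no _  = just (y , j)
    ... | yes _ with β (x , not j)
    ...   | nothing = nothing
    ...   | just e  = avoid e

    bypass : Dart → Maybe Dart
    bypass (y , j) with y ≟A x
    ... | yes _ = nothing
    ... | no _ with β (y , j)
    ...   | nothing = nothing
    ...   | just e  = through e

    -- The specification of `bypass`: a pair of `β` missing `x`, or the two pairs at the darts of
    -- `x` merged into one. The properties of `bypass` are proved on this relation.
    data Bypass (d e : Dart) : Set where
      direct   : proj₁ d ≢ x → proj₁ e ≢ x → β d ≡ just e → Bypass d e
      indirect : ∀ i → proj₁ d ≢ x → proj₁ e ≢ x → β d ≡ just (x , i) → β (x , not i) ≡ just e → Bypass d e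

    avoid-just : ∀ {d e} → avoid d ≡ just e → d ≡ e × proj₁ e ≢ x
    avoid-just {y , j} eq with y ≟A x
    avoid-just {y , j} refl | no y≢x = refl , y≢x

    avoid-≢ : ∀ {d} → proj₁ d ≢ x → avoid d ≡ just d
    avoid-≢ {y , j} y≢x with y ≟A x
    ... | yes y≡x = contradiction y≡x y≢x
    ... | no _    = refl

    bypass-sound : ∀ {d e} → bypass d ≡ just e → Bypass d e
    bypass-sound {y , j} eq with y ≟A x
    ... | no y≢x with β (y , j) in e₁
    ...   | just (z , k) with z ≟A x
    bypass-sound {y , j} refl | no y≢x | just (z , k) | no z≢x = direct y≢x z≢x e₁
    ...     | yes refl with β (x , not k) in e₂
    ...       | just w with avoid-just {w} eq
    ...         | refl , w≢x = indirect k y≢x w≢x e₁ e₂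

    bypass-complete : ∀ {d e} → Bypass d e → bypass d ≡ just e
    bypass-complete {y , j} (direct y≢x z≢x e₁) with y ≟A x
    ... | yes y≡x = contradiction y≡x y≢x
    ... | no _ rewrite e₁ = through-≢ z≢x
      where
      through-≢ : ∀ {d} → proj₁ d ≢ x → through d ≡ just d
      through-≢ {z , k} z≢x with z ≟A x
      ... | yes z≡x = contradiction z≡x z≢x
      ... | no _    = refl
    bypass-complete {y , j} (indirect k y≢x w≢x e₁ e₂) with y ≟A x
    ... | yes y≡x = contradiction y≡x y≢x
    ... | no _ rewrite e₁ with x ≟A x
    ...   | no x≢x = contradiction refl x≢x
    ...   | yes _ rewrite e₂ = avoid-≢ w≢x

  bypass-matching : ∀ {β x xs} → Matching β (x ∷ xs) → Matching (bypass β x) xs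
  bypass-matching {β} {x} {xs} m = record
    { symmetric = λ eq → bypass-complete β x (flip-bypass (bypass-sound β x eq))
    ; irreflexive = λ eq → irrefl′ (bypass-sound β x eq)
    ; within = λ eq → within′ (bypass-sound β x eq) }
    where
    flip-bypass : ∀ {d e} → Bypass β x d e → Bypass β x e d
    flip-bypass (direct d≢ e≢ eq) = direct e≢ d≢ (symmetric m eq)
    flip-bypass {d} (indirect i d≢ e≢ e₁ e₂) = indirect (not i) e≢ d≢ (symmetric m e₂)
      (subst (λ j → β (x , j) ≡ just d) (≡-sym (not-involutive i)) (symmetric m e₁))
    irrefl′ : ∀ {d} → ¬ Bypass β x d d
    irrefl′ (direct _ _ eq) = irreflexive m eq
    -- Both darts of `x` would be the partner of `d`, forcing `i ≡ not i`.
    irrefl′ (indirect i _ _ e₁ e₂) =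
      not-¬ refl (cong proj₂ (just-injective (trans (≡-sym e₁) (symmetric m e₂))))
    tail-∈ : ∀ {y} → y ≢ x → y ∈ x ∷ xs → y ∈ xs
    tail-∈ y≢x (here y≡x) = contradiction y≡x y≢x
    tail-∈ y≢x (there y∈) = y∈
    within′ : ∀ {d e} → Bypass β x d e → proj₁ d ∈ xs
    within′ (direct d≢ _ eq)       = tail-∈ d≢ (within m eq)
    within′ (indirect _ d≢ _ eq _) = tail-∈ d≢ (within m eq)

  Orients : (Dart → Maybe Dart) → (A → Bool) → Set
  Orients β o = ∀ {d e} → β d ≡ just e → side o d ≡ not (side o e)

  orientation : ∀ xs {β} → Matching β xs → ∃ (Orients β)
  orientation [] m = (λ _ → false) , λ eq → contradiction (within m eq) λ ()
  orientation (x ∷ xs) {β} m with orientation xs (bypass-matching m)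
  ... | o , good = o⁺ , good⁺
    where
    Outer : Bool → Dart → Set
    Outer i e = β (x , i) ≡ just e × proj₁ e ≢ x
    outer? : ∀ i → ∃ (Outer i) ⊎ (∀ e → ¬ Outer i e)
    outer? i with β (x , i) in eq
    ... | nothing = inj₂ λ { e (() , _) }
    ... | just (y , j) with y ≟A x
    ...   | no y≢x  = inj₁ ((y , j) , refl , y≢x)
    ...   | yes y≡x = inj₂ λ { _ (refl , y≢x) → y≢x y≡x }
    -- One outer partner determines the value at `x`. If both darts have one, these partners form a
    -- pair of the bypassed matching, so `o` already puts them on opposite sides and the two demands
    -- agree.
    bit : Bool
    bit with outer? false | outer? true
    ... | inj₁ (e , _) | _            = not (side o e)
    ... | inj₂ _       | inj₁ (e , _) = side o e
    ... | inj₂ _       | inj₂ _       = false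
    bit-good : ∀ i {e} → Outer i e → bit xor i ≡ not (side o e)
    bit-good false {e} (eq , e≢x) with outer? false | outer? true
    ... | inj₂ none           | _ = contradiction (eq , e≢x) (none e)
    ... | inj₁ (e′ , eq′ , _) | _ with just-injective (trans (≡-sym eq) eq′)
    ...   | refl = xor-identityʳ _
    bit-good true {e} (eq , e≢x) with outer? false | outer? true
    ... | inj₂ _ | inj₂ none = contradiction (eq , e≢x) (none e)
    ... | inj₁ (d , eq′ , d≢x) | _ = trans (xor-true _) (cong not
            (trans (cong not (good (bypass-complete β x (indirect false d≢x e≢x (symmetric m eq′) eq))))
                   (not-involutive (side o e))))
    ... | inj₂ _ | inj₁ (e′ , eq′ , _) with just-injective (trans (≡-sym eq) eq′)
    ...   | refl = xor-true _
    o⁺ : A → Bool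
    o⁺ y with y ≟A x
    ... | yes _ = bit
    ... | no _  = o y
    not-flip : ∀ {a b} → a ≡ not b → b ≡ not a
    not-flip {a} {b} eq = trans (≡-sym (not-involutive b)) (cong not (≡-sym eq))
    good⁺ : Orients β o⁺
    good⁺ {y , j} {z , k} eq with y ≟A x | z ≟A x
    ... | no y≢x   | no z≢x   = good (bypass-complete β x (direct y≢x z≢x eq))
    ... | yes refl | no z≢x   = bit-good j (eq , z≢x)
    ... | no y≢x   | yes refl = not-flip (bit-good k (symmetric m eq , y≢x))
    ... | yes refl | yes refl = opposite bit j k λ { refl → irreflexive m eq }
      where
      opposite : ∀ b j k → j ≢ k → b xor j ≡ not (b xor k)
      opposite b false false ne = contradiction refl ne
      opposite b true  true  ne = contradiction refl ne
      opposite b false true  ne = trans (xor-identityʳ b)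
        (trans (≡-sym (not-involutive b)) (cong not (≡-sym (xor-true b))))
      opposite b true  false ne = trans (xor-true b) (cong not (≡-sym (xor-identityʳ b)))

-- Truth assignments without three consecutive true literals.

module Assignment {m : ℕ} where

  Literal : Set
  Literal = Fin m × Bool

  ¬ₗ : Literal → Literal
  ¬ₗ (x , b) = x , not b

  ¬ₗ-≢ : ∀ ℓ → ℓ ≢ ¬ₗ ℓ
  ¬ₗ-≢ (x , true)  ()
  ¬ₗ-≢ (x , false) ()

  Partial : Set
  Partial = Fin m → Maybe Bool

  infix 4 _⊨_
  _⊨_ : Partial → Literal → Set
  α ⊨ (x , b) = α x ≡ just b

  Unassigned Assigned : Partial → Literal → Set
  Unassigned α (x , _) = α x ≡ nothing
  Assigned α ℓ = α ⊨ ℓ ⊎ α ⊨ ¬ₗ ℓ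

  assign : Partial → Literal → Partial
  assign α (x , b) = updateAt α x (const (just b))

  status : ∀ α ℓ → Unassigned α ℓ ⊎ Assigned α ℓ
  status α (x , b) with α x
  ... | nothing = inj₁ refl
  status α (x , true)  | just true  = inj₂ (inj₁ refl)
  status α (x , true)  | just false = inj₂ (inj₂ refl)
  status α (x , false) | just true  = inj₂ (inj₂ refl)
  status α (x , false) | just false = inj₂ (inj₁ refl)

  assigned≢unassigned : ∀ α {ℓ} → Assigned α ℓ → ¬ Unassigned α ℓ
  assigned≢unassigned α (inj₁ t) u = contradiction (trans (≡-sym t) u) λ ()
  assigned≢unassigned α (inj₂ t) u = contradiction (trans (≡-sym t) u) λ ()

  ⊨-consistent : ∀ α {ℓ} → α ⊨ ℓ → ¬ α ⊨ ¬ₗ ℓ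
  ⊨-consistent α {x , b} t f = not-¬ refl (just-injective (trans (≡-sym t) f))

  free : Partial → Fin m → Bool
  free α x with α x
  ... | nothing = true
  ... | just _  = false

  free-true : ∀ α x → free α x ≡ true → α x ≡ nothing
  free-true α x eq with α x
  ... | nothing = refl

  free-unassigned : ∀ α x → α x ≡ nothing → free α x ≡ true
  free-unassigned α x eq rewrite eq = refl

  module _ {α : Partial} {ℓ : Literal} (u : Unassigned α ℓ) where

    ⊨-assign : assign α ℓ ⊨ ℓ
    ⊨-assign = updateAt-updates (proj₁ ℓ) α

    assign-old : ∀ {k} → α ⊨ k → assign α ℓ ⊨ k
    assign-old {k} t = trans (updateAt-minimal (proj₁ k) (proj₁ ℓ) α
      (λ eq → contradiction (trans (≡-sym t) (subst (λ x → α x ≡ nothing) (≡-sym eq) u)) λ ())) t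

    assign-new : ∀ {k} → assign α ℓ ⊨ k → α ⊨ k ⊎ k ≡ ℓ
    assign-new {x , b} t with x ≟F proj₁ ℓ
    ... | no x≢   = inj₁ (trans (≡-sym (updateAt-minimal x (proj₁ ℓ) α x≢)) t)
    ... | yes refl = inj₂ (cong (x ,_) (just-injective (trans (≡-sym t) ⊨-assign)))

    assigned-old : ∀ {k} → Assigned α k → Assigned (assign α ℓ) k
    assigned-old (inj₁ t) = inj₁ (assign-old t)
    assigned-old {k} (inj₂ t) = inj₂ (assign-old {¬ₗ k} t)

    free-assign : card (free α) ≡ suc (card (free (assign α ℓ)))
    free-assign = card-insert (proj₁ ℓ) off (free-unassigned α _ u) rest
      where
      off : free (assign α ℓ) (proj₁ ℓ) ≡ false
      off rewrite ⊨-assign = refl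
      rest : ∀ i → i ≢ proj₁ ℓ → free (assign α ℓ) i ≡ free α i
      rest i i≢ rewrite updateAt-minimal i (proj₁ ℓ) {const (just (proj₂ ℓ))} α i≢ = refl

  -- Literals are threaded on paths and cycles by partial functions right and left.
  -- A literal that becomes true makes its right neighbour false if that one is still
  -- unassigned, and otherwise its left neighbour; the negation of the latter becomes true.
  module _ (right left : Literal → Maybe Literal)
           (left⇒right : ∀ {ℓ k} → left ℓ ≡ just k → right k ≡ just ℓ)
           (right-irrefl : ∀ {ℓ} → right ℓ ≢ just ℓ) where

    Settled : Partial → Literal → Set
    Settled α ℓ = (∀ {r} → right ℓ ≡ just r → Assigned α r)
                × (∀ {r k} → right ℓ ≡ just r → α ⊨ r → left ℓ ≡ just k → α ⊨ ¬ₗ k)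

    Invariant : Partial → Set
    Invariant α = ∀ {ℓ} → α ⊨ ℓ → Settled α ℓ

    -- One true literal at a time awaits treatment. By `no-true-left` its left neighbour is not true
    -- yet, so it is false already or can still be made false.
    record Pending (α : Partial) (ℓ : Literal) : Set where
      field
        holds          : α ⊨ ℓ
        others-settled : ∀ {k} → α ⊨ k → k ≢ ℓ → Settled α k
        no-true-left   : ∀ {k} → right k ≡ just ℓ → ¬ α ⊨ k
    open Pending

    -- Stability rests on the first clause of `Settled`: the right neighbour of `k` already has a
    -- value, so a new assignment cannot turn it true and create a fresh demand on the left
    -- neighbour.
    Settled-assign : ∀ {α k ℓ} → Unassigned α ℓ → α ⊨ k → Settled α k → Settled (assign α ℓ) k
    Settled-assign {α} {k} {ℓ} u t (right-assigned , left-false) =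
      (λ e → assigned-old u (right-assigned e)) , left-false′
      where
      left-false′ : ∀ {r j} → right k ≡ just r → assign α ℓ ⊨ r → left k ≡ just j → assign α ℓ ⊨ ¬ₗ j
      left-false′ {r} {j} e tr e′ with assign-new u {r} tr
      ... | inj₁ old  = assign-old u {¬ₗ j} (left-false e old e′)
      ... | inj₂ refl = contradiction u (assigned≢unassigned α {r} (right-assigned e))

    settle : ∀ {α ℓ} → Pending α ℓ → Settled α ℓ → Invariant α
    settle {ℓ = ℓ} p s {k} t with proj₁ k ≟F proj₁ ℓ
    ... | no x≢ = others-settled p t (x≢ ∘ cong proj₁)
    ... | yes refl with just-injective (trans (≡-sym t) (holds p))
    ...   | refl = s

    start : ∀ {α ℓ} → Invariant α → Unassigned α ℓ → Pending (assign α ℓ) ℓ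
    start {α} {ℓ} inv u = record
      { holds          = ⊨-assign u
      ; others-settled = λ {k} t k≢ → Settled-assign {k = k} u (before t k≢) (inv (before t k≢))
      -- A true `k` was settled before, so its right neighbour `ℓ` would have been assigned already.
      ; no-true-left   = λ {k} e t →
          let t′ = before t λ { refl → right-irrefl e }
          in assigned≢unassigned α {ℓ} (proj₁ (inv {k} t′) e) u }
      where
      before : ∀ {k} → assign α ℓ ⊨ k → k ≢ ℓ → α ⊨ k
      before {k} t k≢ with assign-new u {k} t
      ... | inj₁ old = old
      ... | inj₂ eq  = contradiction eq k≢

    -- Making k false settles ℓ; the negation of k is pending in turn.
    pass : ∀ {α ℓ k} → Pending α ℓ → Unassigned α k → Settled (assign α (¬ₗ k)) ℓ →
      right ℓ ≢ just (¬ₗ k) → Pending (assign α (¬ₗ k)) (¬ₗ k)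
    pass {α} {ℓ} {k} p u s r≢ = record
      { holds          = ⊨-assign u
      ; others-settled = settled′
      ; no-true-left   = no-left }
      where
      β = assign α (¬ₗ k)
      settled′ : ∀ {j} → β ⊨ j → j ≢ ¬ₗ k → Settled β j
      settled′ {j} t j≢ with assign-new u {j} t
      ... | inj₂ eq = contradiction eq j≢
      ... | inj₁ old with proj₁ j ≟F proj₁ ℓ
      ...   | no x≢ = Settled-assign {k = j} u old (others-settled p old (x≢ ∘ cong proj₁))
      ...   | yes refl with just-injective (trans (≡-sym old) (holds p))
      ...     | refl = s
      -- A true `j` to the left of the new literal is not that literal itself by `right-irrefl`, not
      -- a settled one since its right neighbour was unassigned, and not `ℓ` by `r≢`.
      no-left : ∀ {j} → right j ≡ just (¬ₗ k) → ¬ β ⊨ j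
      no-left {j} e t with assign-new u {j} t
      ... | inj₂ refl = right-irrefl e
      ... | inj₁ old with proj₁ j ≟F proj₁ ℓ
      ...   | no x≢ = assigned≢unassigned α {¬ₗ k} (proj₁ (others-settled p old (x≢ ∘ cong proj₁)) e) u
      ...   | yes refl with just-injective (trans (≡-sym old) (holds p))
      ...     | refl = r≢ e

    Complete : Set
    Complete = ∃ λ (a : Fin m → Bool) → ∀ {x r k} → right (x , a x) ≡ just r → left (x , a x) ≡ just k →
      a (proj₁ r) ≡ proj₂ r → a (proj₁ k) ≢ proj₂ k

    mutual
      -- `fuel` bounds the number of free variables; each new start and each `step` assigns one of
      -- them. Once none is free, the second clause of `Settled` is the claim.
      complete : ∀ fuel α → card (free α) ≤ fuel → Invariant α → Complete
      complete fuel α le inv with anyF? (λ x → free α x ≟B true)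
      complete fuel α le inv | no none = a , good
        where
        value : ∀ x → ∃ λ b → α x ≡ just b
        value x with α x in eq
        ... | just b  = b , refl
        ... | nothing = contradiction (x , free-unassigned α x eq) none
        a : Fin m → Bool
        a x = proj₁ (value x)
        holds-a : ∀ ℓ → a (proj₁ ℓ) ≡ proj₂ ℓ → α ⊨ ℓ
        holds-a (x , _) refl = proj₂ (value x)
        good : ∀ {x r k} → right (x , a x) ≡ just r → left (x , a x) ≡ just k →
          a (proj₁ r) ≡ proj₂ r → a (proj₁ k) ≢ proj₂ k
        good {x} {r} {k} er ek ar ak = ⊨-consistent α {k} (holds-a k ak)
          (proj₂ (inv {x , a x} (holds-a _ refl)) er (holds-a r ar) ek)
      complete zero α le inv | yes (x , e) = contradiction (≤-trans (card≥1 (free α) e) le) λ ()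
      complete (suc fuel) α le inv | yes (x , e) =
        continue fuel (assign α (x , true)) (x , true)
          (s≤s⁻¹ (subst (_≤ suc fuel) (free-assign {ℓ = x , true} u) le)) (start inv u)
        where u = free-true α x e

      continue : ∀ fuel α ℓ → card (free α) ≤ fuel → Pending α ℓ → Complete
      continue fuel α ℓ le p with right ℓ in er
      ... | nothing = turn-left fuel α ℓ le p (λ e → contradiction (trans (≡-sym er) e) λ ())
      ... | just r with status α r
      ...   | inj₂ as = turn-left fuel α ℓ le p
                (λ e → subst (Assigned α) (just-injective (trans (≡-sym er) e)) as)
      ...   | inj₁ u = step fuel α ℓ r le p u
                ((λ e → inj₂ (false-right e)) ,
                 (λ {r′} e t _ → contradiction (false-right e) (⊨-consistent β {r′} t)))
                (λ e → ¬ₗ-≢ r (just-injective (trans (≡-sym er) e)))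
        where
        β = assign α (¬ₗ r)
        false-right : ∀ {r′} → right ℓ ≡ just r′ → β ⊨ ¬ₗ r′
        false-right e = subst (λ j → β ⊨ ¬ₗ j) (just-injective (trans (≡-sym er) e)) (⊨-assign u)

      turn-left : ∀ fuel α ℓ → card (free α) ≤ fuel → Pending α ℓ →
        (∀ {r} → right ℓ ≡ just r → Assigned α r) → Complete
      turn-left fuel α ℓ le p ra with left ℓ in el
      ... | nothing = complete fuel α le
              (settle p (ra , λ _ _ e → contradiction (trans (≡-sym el) e) λ ()))
      ... | just k with status α k
      ...   | inj₂ (inj₁ t) = contradiction t (no-true-left p (left⇒right el))
      ...   | inj₂ (inj₂ f) = complete fuel α le
                (settle p (ra , λ _ _ e → subst (λ j → α ⊨ ¬ₗ j) (just-injective (trans (≡-sym el) e)) f))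
      ...   | inj₁ u = step fuel α ℓ k le p u
                ((λ e → assigned-old u (ra e)) ,
                 (λ _ _ e → subst (λ j → assign α (¬ₗ k) ⊨ ¬ₗ j) (just-injective (trans (≡-sym el) e)) (⊨-assign u)))
                -- The right neighbour of `ℓ` is assigned while the variable of `k` is free, so that
                -- neighbour is not the negation of `k`.
                (λ e → assigned≢unassigned α {¬ₗ k} (ra e) u)

      step : ∀ fuel α ℓ k → card (free α) ≤ fuel → Pending α ℓ → Unassigned α k →
        Settled (assign α (¬ₗ k)) ℓ → right ℓ ≢ just (¬ₗ k) → Complete
      step zero α ℓ k le p u s r≢ =
        contradiction (≤-trans (card≥1 (free α) (free-unassigned α _ u)) le) λ ()
      step (suc fuel) α ℓ k le p u s r≢ = continue fuel (assign α (¬ₗ k)) (¬ₗ k)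
        (s≤s⁻¹ (subst (_≤ suc fuel) (free-assign {ℓ = ¬ₗ k} u) le)) (pass p u s r≢)

    no-three-consecutive : Complete
    no-three-consecutive = complete m (λ _ → nothing) (card≤ (free (λ _ → nothing))) λ ()

-- Sums over vertices and over colour lists.

sum-δ : ∀ {m} (g : Fin m → ℕ) x → sum (λ i → if does (i ≟F x) then g i else 0) ≡ g x
sum-δ {suc m} g zero    = trans (cong (g zero +_) (sum-zero m)) (+-identityʳ _)
  where
  sum-zero : ∀ m → sum {m} (λ _ → 0) ≡ 0
  sum-zero zero    = refl
  sum-zero (suc m) = sum-zero m
sum-δ {suc m} g (suc x) = sum-δ (g ∘ suc) x

sum-split : ∀ {m} (g : Fin m → ℕ) x → sum g ≡ sum (λ i → if does (i ≟F x) then 0 else g i) + g x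
sum-split g x = begin
  sum g                                           ≡⟨ sum-cong-≗ split ⟩
  sum (λ i → rest i + at i)                       ≡⟨ ∑-distrib-+ rest at ⟩
  sum rest + sum at                               ≡⟨ cong (sum rest +_) (sum-δ g x) ⟩
  sum rest + g x                                  ∎
  where
  open ≡-Reasoning
  rest at : Fin _ → ℕ
  rest i = if does (i ≟F x) then 0 else g i
  at i   = if does (i ≟F x) then g i else 0
  split : ∀ i → g i ≡ rest i + at i
  split i with does (i ≟F x)
  ... | true  = refl
  ... | false = ≡-sym (+-identityʳ _)

card-split : ∀ {m} (p q : Fin m → Bool) → card p ≡ card (λ i → p i ∧ q i) + card (λ i → p i ∧ not (q i))
card-split p q = trans (sum-cong-≗ split) (∑-distrib-+ (λ i → [ p i ∧ q i ]) (λ i → [ p i ∧ not (q i) ]))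
  where
  split : ∀ i → [ p i ] ≡ [ p i ∧ q i ] + [ p i ∧ not (q i) ]
  split i with p i | q i
  ... | false | _     = refl
  ... | true  | true  = refl
  ... | true  | false = refl

-- Classes of distinct colours are disjoint: the induction removes the class of the first colour
-- from `p`, which leaves the later classes unchanged.
colour-classes : ∀ {m} (f : Fin m → ℕ) {cs} → Unique cs → (p : Fin m → Bool) →
  sumₗ (map (λ c → card (λ u → p u ∧ does (f u ≟ c))) cs) ≤ card p
colour-classes f []          p = z≤n
colour-classes f {c ∷ cs} (c∉ ∷ un) p = begin
  size p c + sumₗ (map (size p) cs)   ≡⟨ cong (size p c +_) (rest cs c∉) ⟩
  size p c + sumₗ (map (size p′) cs)  ≤⟨ +-monoʳ-≤ (size p c) (colour-classes f un p′) ⟩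
  size p c + card p′                  ≡⟨ ≡-sym (card-split p (λ u → does (f u ≟ c))) ⟩
  card p                              ∎
  where
  open ≤-Reasoning
  p′ : Fin _ → Bool
  p′ u = p u ∧ not (does (f u ≟ c))
  size : (Fin _ → Bool) → ℕ → ℕ
  size q d = card (λ u → q u ∧ does (f u ≟ d))
  rest : ∀ ds → All (c ≢_) ds → sumₗ (map (size p) ds) ≡ sumₗ (map (size p′) ds)
  rest []       []           = refl
  rest (d ∷ ds) (c≢d ∷ c≢ds) = cong₂ _+_ (card-cong same) (rest ds c≢ds)
    where
    same : ∀ u → p u ∧ does (f u ≟ d) ≡ p′ u ∧ does (f u ≟ d)
    same u with f u ≟ d
    ... | yes fu≡d rewrite dec-false (f u ≟ c) (λ fu≡c → c≢d (trans (≡-sym fu≡c) fu≡d)) | ∧-identityʳ (p u) = refl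
    ... | no fu≢d rewrite dec-false (f u ≟ d) fu≢d | ∧-zeroʳ (p u) | ∧-zeroʳ (p′ u) = refl

sum-map-+ : ∀ (w w′ : ℕ → ℕ) cs → sumₗ (map (λ c → w c + w′ c) cs) ≡ sumₗ (map w cs) + sumₗ (map w′ cs)
sum-map-+ w w′ []       = refl
sum-map-+ w w′ (c ∷ cs) rewrite sum-map-+ w w′ cs = +-interchange (w c) (w′ c) _ _

sum-map-≥ : ∀ {k} (w : ℕ → ℕ) cs → (∀ {c} → c ∈ cs → k ≤ w c) → length cs * k ≤ sumₗ (map w cs)
sum-map-≥ w []       _  = z≤n
sum-map-≥ w (c ∷ cs) le = +-mono-≤ (le (here refl)) (sum-map-≥ w cs (le ∘ there))

-- As `cs` has no repetitions, `a` occurs at most once; its deficit of one is the `suc` on the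
-- right.
sum-map-≥-except : ∀ {k} (w : ℕ → ℕ) a {cs} → Unique cs → (∀ {c} → c ∈ cs → k ≤ w c) →
  (∀ {c} → c ∈ cs → c ≢ a → suc k ≤ w c) → length cs * suc k ≤ suc (sumₗ (map w cs))
sum-map-≥-except w a []          _  _  = z≤n
sum-map-≥-except {k} w a {c ∷ cs} (c∉ ∷ un) le lt with c ≟ a
... | no c≢a   = subst (suc k + length cs * suc k ≤_) (+-suc (w c) _)
                   (+-mono-≤ (lt (here refl) c≢a) (sum-map-≥-except w a un (le ∘ there) (lt ∘ there)))
... | yes refl = s≤s (+-mono-≤ (le (here refl))
                   (sum-map-≥ w cs (λ c∈ → lt (there c∈) λ { refl → All¬⇒¬Any c∉ c∈ })))

length-filter-tabulate : ∀ {m} {A : Set} (p : A → Bool) (g : Fin m → A) →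
  length (filterᵇ p (tabulate g)) ≡ card (p ∘ g)
length-filter-tabulate {zero}  p g = refl
length-filter-tabulate {suc m} p g with p (g zero)
... | true  = cong suc (length-filter-tabulate p (g ∘ suc))
... | false = length-filter-tabulate p (g ∘ suc)

unique-⊆-length : ∀ {A : Set} {xs ys : List A} → Unique xs → (∀ {x} → x ∈ xs → x ∈ ys) → length xs ≤ length ys
unique-⊆-length []           _   = z≤n
unique-⊆-length {xs = x ∷ xs} (x∉ ∷ un) sub with ∈-∃++ (sub (here refl))
... | as , bs , refl = subst (suc (length xs) ≤_)
        (≡-sym (trans (length-++ as) (trans (+-suc (length as) (length bs)) (cong suc (≡-sym (length-++ as))))))
        (s≤s (unique-⊆-length un drop))
  where
  drop : ∀ {y} → y ∈ xs → y ∈ as ++ bs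
  drop y∈ with ∈-++⁻ as (sub (there y∈))
  ... | inj₁ y∈as         = ∈-++⁺ˡ y∈as
  ... | inj₂ (here refl)  = contradiction y∈ (All¬⇒¬Any x∉)
  ... | inj₂ (there y∈bs) = ∈-++⁺ʳ as y∈bs

-- Monochromatic degrees and colourings of minimal weight.

module Colourings (G : Graph) (L : Fin (n G) → List ℕ) (L-unique : ∀ v → Unique (L v))
                  (L-long : ∀ v → 2 * suc (degree G v) ≤ 5 * length (L v)) where

  V : Set
  V = Fin (n G)

  E : V → V → Bool
  E = adj G

  E-sym : ∀ {u v} → E u v ≡ true → E v u ≡ true
  E-sym {u} {v} e = trans (sym G v u) e

  Colouring : (V → ℕ) → Set
  Colouring f = ∀ v → f v ∈ L v

  recolour : (V → ℕ) → V → ℕ → V → ℕ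
  recolour f x c = updateAt f x (const c)

  recolour-at : ∀ f x c → recolour f x c x ≡ c
  recolour-at f x c = updateAt-updates x f

  recolour-off : ∀ f x c {u} → u ≢ x → recolour f x c u ≡ f u
  recolour-off f x c {u} = updateAt-minimal u x f

  nbr : (V → ℕ) → ℕ → V → V → Bool
  nbr f c v u = E v u ∧ does (f u ≟ c)

  nbr⁺ : ∀ {f c v u} → E v u ≡ true → f u ≡ c → nbr f c v u ≡ true
  nbr⁺ {f} {c} {v} {u} e eq rewrite e = dec-true (f u ≟ c) eq

  nbr⁻ : ∀ {f c v u} → nbr f c v u ≡ true → E v u ≡ true × f u ≡ c
  nbr⁻ {f} {c} {v} {u} eq with E v u
  ... | true with f u ≟ c
  ...   | yes fu≡c = refl , fu≡c
  ...   | no fu≢c  = contradiction (trans (≡-sym (dec-false (f u ≟ c) fu≢c)) eq) λ ()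

  nbr-false : ∀ {f c v u} → f u ≢ c → nbr f c v u ≡ false
  nbr-false {f} {c} {v} {u} fu≢c rewrite dec-false (f u ≟ c) fu≢c = ∧-zeroʳ (E v u)

  cnt : (V → ℕ) → ℕ → V → ℕ
  cnt f c v = card (nbr f c v)

  nbr-cong : ∀ {f g} → f ≗ g → ∀ c v → nbr f c v ≗ nbr g c v
  nbr-cong f≗g c v u = cong (λ d → E v u ∧ does (d ≟ c)) (f≗g u)

  cnt-cong : ∀ {f g} → f ≗ g → ∀ c v → cnt f c v ≡ cnt g c v
  cnt-cong f≗g c v = card-cong (nbr-cong f≗g c v)

  cnt-mono : ∀ {f g c d v} → (∀ {u} → E v u ≡ true → f u ≡ c → g u ≡ d) → cnt f c v ≤ cnt g d v
  cnt-mono {f} {g} {c} {d} {v} imp = card-mono λ u eq →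
    let e , fu = nbr⁻ {f} {c} {v} {u} eq in nbr⁺ {g} {d} {v} {u} e (imp e fu)

  cnt-strict : ∀ {f g c d v} w → (∀ {u} → E v u ≡ true → f u ≡ c → g u ≡ d) →
    E v w ≡ true → f w ≢ c → g w ≡ d → suc (cnt f c v) ≤ cnt g d v
  cnt-strict {f} {g} {c} {d} {v} w imp e fw gw = card-strict w
    (λ u eq → let e′ , fu = nbr⁻ {f} {c} {v} {u} eq in nbr⁺ {g} {d} {v} {u} e′ (imp e′ fu))
    (nbr-false {f} {c} {v} {w} fw) (nbr⁺ {g} {d} {v} {w} e gw)

  cnt≥2 : ∀ {f c v a b} → a ≢ b → E v a ≡ true → f a ≡ c → E v b ≡ true → f b ≡ c → 2 ≤ cnt f c v
  cnt≥2 {f} {c} {v} a≢b ea fa eb fb =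
    card≥2 (nbr f c v) a≢b (nbr⁺ {f} {c} {v} ea fa) (nbr⁺ {f} {c} {v} eb fb)

  cnt≤2 : ∀ {f c v x y z} → cnt f c v ≤ 2 → x ≢ y → x ≢ z → y ≢ z →
    E v x ≡ true → f x ≡ c → E v y ≡ true → f y ≡ c → E v z ≡ true → f z ≡ c → ⊥
  cnt≤2 {f} {c} {v} le xy xz yz ex fx ey fy ez fz = <⇒≱
    (card≥3 (nbr f c v) xy xz yz (nbr⁺ {f} {c} {v} ex fx) (nbr⁺ {f} {c} {v} ey fy) (nbr⁺ {f} {c} {v} ez fz)) le

  pick-nbrs : ∀ f c v → 2 ≤ cnt f c v →
    ∃₂ λ a b → a ≢ b × (E v a ≡ true × f a ≡ c) × (E v b ≡ true × f b ≡ c)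
  pick-nbrs f c v le with pick₂ (nbr f c v) le
  ... | a , b , a≢b , pa , pb = a , b , a≢b , nbr⁻ {f} {c} {v} pa , nbr⁻ {f} {c} {v} pb

  -- Twice the number of monochromatic edges, each being counted from both endpoints.
  weight : (V → ℕ) → ℕ
  weight f = sum (λ v → cnt f (f v) v)

  weight-cong : ∀ {f g} → f ≗ g → weight f ≡ weight g
  weight-cong {f} {g} f≗g = sum-cong-≗ λ v → trans (cnt-cong f≗g (f v) v) (cong (λ c → cnt g c v) (f≗g v))

  -- The contribution of `v` to the weight through edges avoiding `x`; it does not depend on the
  -- colour of `x`.
  away : (V → ℕ) → V → V → ℕ
  away f x v = if does (v ≟F x) then 0 else sum (λ u → if does (u ≟F x) then 0 else [ nbr f (f v) v u ])

  away-cong : ∀ {f g x} → (∀ {u} → u ≢ x → f u ≡ g u) → ∀ v → away f x v ≡ away g x v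
  away-cong {f} {g} {x} eq v with v ≟F x
  ... | yes _  = refl
  ... | no v≢x = sum-cong-≗ pointwise
    where
    pointwise : ∀ u → (if does (u ≟F x) then 0 else [ nbr f (f v) v u ]) ≡ (if does (u ≟F x) then 0 else [ nbr g (g v) v u ])
    pointwise u with u ≟F x
    ... | yes _  = refl
    ... | no u≢x rewrite eq v≢x | eq u≢x = refl

  -- In the symmetric matrix of monochromatic adjacency, the row and the column of `x` both sum to
  -- the monochromatic degree of `x`, and their common diagonal entry is 0.
  weight-at : ∀ f x → weight f ≡ sum (away f x) + (cnt f (f x) x + cnt f (f x) x)
  weight-at f x = begin
    weight f                                        ≡⟨ sum-cong-≗ row ⟩
    sum (λ v → (away f x v + at v) + column v)      ≡⟨ ∑-distrib-+ (λ v → away f x v + at v) column ⟩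
    sum (λ v → away f x v + at v) + sum column      ≡⟨ cong (_+ sum column) (∑-distrib-+ (away f x) at) ⟩
    (sum (away f x) + sum at) + sum column          ≡⟨ cong₂ (λ a b → (sum (away f x) + a) + b)
                                                             (sum-δ (λ _ → cnt f (f x) x) x) (sum-cong-≗ column≡) ⟩
    (sum (away f x) + cnt f (f x) x) + cnt f (f x) x ≡⟨ +-assoc (sum (away f x)) _ _ ⟩
    sum (away f x) + (cnt f (f x) x + cnt f (f x) x) ∎
    where
    open ≡-Reasoning
    at column : V → ℕ
    at v     = if does (v ≟F x) then cnt f (f x) x else 0
    column v = [ nbr f (f v) v x ]
    column≡ : ∀ v → column v ≡ [ nbr f (f x) x v ]
    column≡ v rewrite sym G v x with f x ≟ f v
    ... | yes eq rewrite dec-true (f x ≟ f v) eq | dec-true (f v ≟ f x) (≡-sym eq) = refl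
    ... | no ne  rewrite dec-false (f x ≟ f v) ne | dec-false (f v ≟ f x) (ne ∘ ≡-sym) = refl
    row : ∀ v → cnt f (f v) v ≡ (away f x v + at v) + column v
    row v with v ≟F x
    ... | yes refl rewrite irrefl G x = ≡-sym (+-identityʳ _)
    ... | no _ = trans (sum-split (λ u → [ nbr f (f v) v u ]) x) (cong (_+ column v) (≡-sym (+-identityʳ _)))

  cnt-recolour : ∀ f x c → cnt (recolour f x c) c x ≡ cnt f c x
  cnt-recolour f x c = card-cong same
    where
    same : ∀ u → nbr (recolour f x c) c x u ≡ nbr f c x u
    same u with u ≟F x
    ... | yes refl rewrite irrefl G x = refl
    ... | no u≢x rewrite recolour-off f x c u≢x = refl

  weight-recolour : ∀ f x c → weight (recolour f x c) ≡ sum (away f x) + (cnt f c x + cnt f c x)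
  weight-recolour f x c = begin
    weight g                                         ≡⟨ weight-at g x ⟩
    sum (away g x) + (cnt g (g x) x + cnt g (g x) x) ≡⟨ cong₂ (λ a b → a + (b + b))
                                                          (sum-cong-≗ (away-cong (recolour-off f x c)))
                                                          (trans (cong (λ d → cnt g d x) (recolour-at f x c)) (cnt-recolour f x c)) ⟩
    sum (away f x) + (cnt f c x + cnt f c x)         ∎
    where
    open ≡-Reasoning
    g = recolour f x c

  recolour-≤ : ∀ f x c → cnt f c x ≤ cnt f (f x) x → weight (recolour f x c) ≤ weight f
  recolour-≤ f x c le rewrite weight-recolour f x c | weight-at f x =
    +-monoʳ-≤ (sum (away f x)) (+-mono-≤ le le)

  recolour-≤⁻ : ∀ f x c → weight f ≤ weight (recolour f x c) → cnt f (f x) x ≤ cnt f c x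
  recolour-≤⁻ f x c le rewrite weight-recolour f x c | weight-at f x =
    ≮⇒≥ λ lt → <⇒≱ (+-mono-< lt lt) (+-cancelˡ-≤ (sum (away f x)) _ _ le)

  Minimal : (V → ℕ) → Set
  Minimal f = Colouring f × (∀ {g} → Colouring g → weight f ≤ weight g)

  recolour-colouring : ∀ {f x c} → Colouring f → c ∈ L x → Colouring (recolour f x c)
  recolour-colouring {f} {x} {c} col c∈ v with v ≟F x
  ... | yes refl = subst (_∈ L x) (≡-sym (recolour-at f x c)) c∈
  ... | no v≢x   = subst (_∈ L v) (≡-sym (recolour-off f x c v≢x)) (col v)

  Minimal-recolour : ∀ {f x c} → Minimal f → c ∈ L x → cnt f c x ≤ cnt f (f x) x → Minimal (recolour f x c)
  Minimal-recolour {f} {x} {c} (col , min) c∈ le =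
    recolour-colouring col c∈ , λ col′ → ≤-trans (recolour-≤ f x c le) (min col′)

  Minimal-cong : ∀ {f g} → f ≗ g → Minimal f → Minimal g
  Minimal-cong f≗g (col , min) =
    (λ v → subst (_∈ L v) (f≗g v) (col v)) , λ col′ → subst (_≤ _) (weight-cong f≗g) (min col′)

  -- Otherwise giving `v` the colour `c` would lower the weight.
  own-≤ : ∀ {f} → Minimal f → ∀ {v c} → c ∈ L v → cnt f (f v) v ≤ cnt f c v
  own-≤ {f} (col , min) {v} {c} c∈ = recolour-≤⁻ f v c (min (recolour-colouring col c∈))

  degree≡ : ∀ v → degree G v ≡ card (E v)
  degree≡ v = length-filter-tabulate (E v) id

  colours-≤ : ∀ f v → sumₗ (map (λ c → cnt f c v) (L v)) ≤ degree G v
  colours-≤ f v = subst (sumₗ (map (λ c → cnt f c v) (L v)) ≤_) (≡-sym (degree≡ v)) (colour-classes f (L-unique v) (E v))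

  -- By `own-≤`, three neighbours in the own colour mean three in every colour of the list. The
  -- degree would be at least three times the list length, but twice the degree is less than five
  -- times that length.
  own≤2 : ∀ {f} → Minimal f → ∀ v → cnt f (f v) v ≤ 2
  own≤2 {f} m v = ≮⇒≥ λ lt → n≮n (2 * degree G v) (begin-strict
    2 * degree G v       <⟨ *-monoʳ-< 2 (n<1+n _) ⟩
    2 * suc (degree G v) ≤⟨ L-long v ⟩
    5 * length (L v)     ≤⟨ *-monoˡ-≤ (length (L v)) (n≤1+n 5) ⟩
    6 * length (L v)     ≡⟨ *-assoc 2 3 (length (L v)) ⟩
    2 * (3 * length (L v)) ≡⟨ cong (2 *_) (*-comm 3 (length (L v))) ⟩
    2 * (length (L v) * 3) ≤⟨ *-monoʳ-≤ 2 (sum-map-≥ (λ c → cnt f c v) (L v) (λ c∈ → ≤-trans lt (own-≤ m c∈))) ⟩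
    2 * sumₗ (map (λ c → cnt f c v) (L v)) ≤⟨ *-monoʳ-≤ 2 (colours-≤ f v) ⟩
    2 * degree G v       ∎)
    where open ≤-Reasoning

  -- Otherwise the colours of L x have at least 5|L x| − 1 neighbours of x in f and g together,
  -- but x has at most 2 degree x ≤ 5|L x| − 2 of them. This is where the factor 2/5 is needed.
  common-alternative : ∀ {f g} → Minimal f → Minimal g → ∀ {x} → f x ≡ g x → 2 ≤ cnt f (f x) x → 2 ≤ cnt g (g x) x →
    ∃ λ c → c ∈ L x × c ≢ f x × cnt f c x ≤ 2 × cnt g c x ≤ 2
  common-alternative {f} {g} mf mg {x} eq lf lg
    with any? (λ c → ¬? (c ≟ f x) ×-dec (cnt f c x ≤? 2) ×-dec (cnt g c x ≤? 2)) (L x)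
  ... | yes found with find found
  ...   | c , c∈ , prop = c , c∈ , prop
  common-alternative {f} {g} mf mg {x} eq lf lg | no none = contradiction chain (n≮n (5 * length (L x)))
    where
    open ≤-Reasoning
    f≥2 : ∀ {c} → c ∈ L x → 2 ≤ cnt f c x
    f≥2 c∈ = ≤-trans lf (own-≤ mf c∈)
    g≥2 : ∀ {c} → c ∈ L x → 2 ≤ cnt g c x
    g≥2 c∈ = ≤-trans lg (own-≤ mg c∈)
    five : ∀ {c} → c ∈ L x → c ≢ f x → 5 ≤ cnt f c x + cnt g c x
    five {c} c∈ c≢ with cnt f c x ≤? 2 | cnt g c x ≤? 2
    ... | yes p | yes q = contradiction (lose c∈ (c≢ , p , q)) none
    ... | no p  | _     = +-mono-≤ (≰⇒> p) (g≥2 c∈)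
    ... | yes _ | no q  = +-mono-≤ (f≥2 c∈) (≰⇒> q)
    total = sumₗ (map (λ c → cnt f c x + cnt g c x) (L x))
    chain : 5 * length (L x) < 5 * length (L x)
    chain = begin-strict
      5 * length (L x)  ≡⟨ *-comm 5 (length (L x)) ⟩
      length (L x) * 5  ≤⟨ sum-map-≥-except _ (f x) (L-unique x) (λ c∈ → +-mono-≤ (f≥2 c∈) (g≥2 c∈)) five ⟩
      suc total         ≡⟨ cong suc (sum-map-+ _ _ (L x)) ⟩
      suc (sumₗ (map (λ c → cnt f c x) (L x)) + sumₗ (map (λ c → cnt g c x) (L x)))
                        ≤⟨ s≤s (+-mono-≤ (colours-≤ f x) (colours-≤ g x)) ⟩
      suc (degree G x + degree G x) <⟨ n<1+n _ ⟩
      suc (suc (degree G x + degree G x)) ≡⟨ cong suc (≡-sym (+-suc _ _)) ⟩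
      suc (degree G x) + suc (degree G x) ≡⟨ cong (suc (degree G x) +_) (≡-sym (+-identityʳ _)) ⟩
      2 * suc (degree G x) ≤⟨ L-long x ⟩
      5 * length (L x)  ∎

  -- Sets of recolourable vertices and their second colours.

  record Valid (f : V → ℕ) (S : V → Bool) : Set where
    field
      heavy : ∀ {x} → S x ≡ true → 2 ≤ cnt f (f x) x
      apart : ∀ {x y} → S x ≡ true → S y ≡ true → E x y ≡ true → f x ≢ f y
  open Valid

  -- `few` makes the switch of a single vertex harmless, and `proper` keeps two switched neighbours
  -- from colliding. Collisions of a switched with an unswitched vertex of `S` are excluded by
  -- `alternative-outside`.
  record Alternative (f : V → ℕ) (S : V → Bool) (c : V → ℕ) : Set where
    field
      listed : ∀ {x} → S x ≡ true → c x ∈ L x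
      other  : ∀ {x} → S x ≡ true → c x ≢ f x
      few    : ∀ {x} → S x ≡ true → cnt f (c x) x ≤ 2
      proper : ∀ {x y} → S x ≡ true → S y ≡ true → E x y ≡ true → c x ≢ c y
  open Alternative

  -- Recolouring x by d preserves minimality and gives u one more neighbour of its colour.
  alternative-outside : ∀ {f S} → Minimal f → Valid f S → ∀ {x d u} → 2 ≤ cnt f (f x) x →
    d ∈ L x → d ≢ f x → cnt f d x ≤ 2 → E x u ≡ true → f u ≡ d → S u ≡ false
  alternative-outside {f} {S} m val {x} {d} {u} hx d∈ d≢ few-d e fu≡d = ¬-not λ Su →
    <⇒≱ (≤-trans (s≤s (heavy val Su)) more) (own≤2 (Minimal-recolour m d∈ (≤-trans few-d hx)) u)
    where
    g = recolour f x d
    unchanged : ∀ {w} → f w ≡ f u → g w ≡ f w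
    unchanged fw = recolour-off f x d λ { refl → d≢ (≡-sym (trans fw fu≡d)) }
    more : suc (cnt f (f u) u) ≤ cnt g (g u) u
    more = cnt-strict x (λ _ fw → trans (unchanged fw) (trans fw (≡-sym (unchanged refl)))) (E-sym e)
      (λ fx → d≢ (≡-sym (trans fx fu≡d))) (trans (recolour-at f x d) (≡-sym (trans (unchanged refl) fu≡d)))

  Mixed : (f : V → ℕ) (S : V → Bool) (c : V → ℕ) (g : V → ℕ) → Set
  Mixed f S c g = ∀ w → g w ≡ f w ⊎ (S w ≡ true × g w ≡ c w)

  module _ {f S c} (m : Minimal f) (val : Valid f S) (alt : Alternative f S c) where

    -- By `apart`, the neighbours of `x` coloured `f x` lie outside `S`, so no switch removes them.
    mixed-own : ∀ {g} → Mixed f S c g → ∀ {x} → S x ≡ true → cnt f (f x) x ≤ cnt g (f x) x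
    mixed-own {g} mix {x} Sx = cnt-mono unmoved
      where
      unmoved : ∀ {w} → E x w ≡ true → f w ≡ f x → g w ≡ f x
      unmoved {w} e fw with mix w
      ... | inj₁ eq       = trans eq fw
      ... | inj₂ (Sw , _) = contradiction (≡-sym fw) (apart val Sx Sw e)

    -- By `proper`, no neighbour of `x` is switched to `c x`.
    mixed-other : ∀ {g} → Mixed f S c g → ∀ {x} → S x ≡ true → cnt g (c x) x ≤ cnt f (c x) x
    mixed-other {g} mix {x} Sx = cnt-mono unmoved
      where
      unmoved : ∀ {w} → E x w ≡ true → g w ≡ c x → f w ≡ c x
      unmoved {w} e gw with mix w
      ... | inj₁ eq        = trans (≡-sym eq) gw
      ... | inj₂ (Sw , eq) = contradiction (trans (≡-sym gw) eq) (proper alt Sx Sw e)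

    -- Induction on the number of switched vertices: one switch, at `w`, is undone and then redone.
    -- Redoing it does not raise the weight, since `w` has at most 2 neighbours coloured `c w` and
    -- at least 2 coloured `f w`, by `few`, `heavy` and the two preceding lemmas.
    Mixed-Minimal : ∀ {g} → Mixed f S c g → Minimal g
    Mixed-Minimal mix = go _ mix ≤-refl
      where
      differs : (V → ℕ) → V → Bool
      differs g w = not (does (g w ≟ f w))
      go : ∀ k {g} → Mixed f S c g → card (differs g) ≤ k → Minimal g
      go k {g} mix le with anyF? (λ w → ¬? (g w ≟ f w))
      go k {g} mix le | no none = Minimal-cong agree m
        where
        agree : f ≗ g
        agree w with g w ≟ f w
        ... | yes eq = ≡-sym eq
        ... | no ne  = contradiction (w , ne) none
      go zero {g} mix le | yes (w , ne) =
        contradiction (≤-trans (card≥1 (differs g) (cong not (dec-false (g w ≟ f w) ne))) le) λ ()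
      go (suc k) {g} mix le | yes (w , ne) with mix w
      ... | inj₁ eq        = contradiction eq ne
      ... | inj₂ (Sw , eq) = Minimal-cong back
              (Minimal-recolour (go k mix′ (s≤s⁻¹ (≤-trans fewer le))) (listed alt Sw) better)
        where
        g′ = recolour g w (f w)
        mix′ : Mixed f S c g′
        mix′ u with u ≟F w
        ... | yes refl = inj₁ (recolour-at g w (f w))
        ... | no u≢w rewrite recolour-off g w (f w) u≢w = mix u
        fewer : suc (card (differs g′)) ≤ card (differs g)
        fewer = card-strict w still (cong not (dec-true (g′ w ≟ f w) (recolour-at g w (f w))))
                  (cong not (dec-false (g w ≟ f w) ne))
          where
          still : ∀ u → differs g′ u ≡ true → differs g u ≡ true
          still u eq with u ≟F w
          ... | yes refl = cong not (dec-false (g w ≟ f w) ne)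
          ... | no u≢w rewrite recolour-off g w (f w) u≢w = eq
        better : cnt g′ (c w) w ≤ cnt g′ (g′ w) w
        better = ≤-trans (mixed-other mix′ Sw) (≤-trans (few alt Sw) (≤-trans (heavy val Sw)
          (subst (λ d → cnt f (f w) w ≤ cnt g′ d w) (≡-sym (recolour-at g w (f w))) (mixed-own mix′ Sw))))
        back : recolour g′ w (c w) ≗ g
        back u with u ≟F w
        ... | yes refl = trans (recolour-at g′ w (c w)) (≡-sym eq)
        ... | no u≢w   = trans (recolour-off g′ w (c w) u≢w) (recolour-off g w (f w) u≢w)

  Valid-∖ : ∀ {f S x} → Valid f S → Valid f (S ∖｛ x ｝)
  Valid-∖ {S = S} val = record
    { heavy = λ Sx → heavy val (proj₂ (∖-⊆ S Sx))
    ; apart = λ Sx Sy → apart val (proj₂ (∖-⊆ S Sx)) (proj₂ (∖-⊆ S Sy)) }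

  -- Second colours are found one vertex at a time. With the rest of `S` switched to give `g`, the
  -- new colour `d` of `x` must suit both `f` and `g`: the bound in `f` yields `few`, the bound in
  -- `g` yields `proper`.
  alternative : ∀ {f} → Minimal f → ∀ k {S} → card S ≤ k → Valid f S → ∃ (Alternative f S)
  alternative {f} m k {S} le val with anyF? (λ w → S w ≟B true)
  alternative {f} m k {S} le val | no none = f , record
    { listed = λ Sx → contradiction (_ , Sx) none ; other = λ Sx → contradiction (_ , Sx) none
    ; few = λ Sx → contradiction (_ , Sx) none ; proper = λ Sx → contradiction (_ , Sx) none }
  alternative m zero {S} le val | yes (x , Sx) = contradiction (≤-trans (card≥1 S Sx) le) λ ()
  alternative {f} m (suc k) {S} le val | yes (x , Sx)
    with alternative m k (s≤s⁻¹ (subst (_≤ suc k) (card-∖ S x Sx) le)) (Valid-∖ {x = x} val)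
  ... | c , alt = extend (common-alternative m mg (≡-sym gx) (heavy val Sx)
                    (subst (λ d → 2 ≤ cnt g d x) (≡-sym gx) (≤-trans (heavy val Sx) own)))
    where
    S₁ = S ∖｛ x ｝
    g : V → ℕ
    g w = if S₁ w then c w else f w
    mix : Mixed f S₁ c g
    mix w with S₁ w
    ... | true  = inj₂ (refl , refl)
    ... | false = inj₁ refl
    g-off : ∀ {w} → S₁ w ≡ false → g w ≡ f w
    g-off eq rewrite eq = refl
    mg : Minimal g
    mg = Mixed-Minimal m (Valid-∖ val) alt mix
    gx : g x ≡ f x
    gx = g-off (updateAt-updates x S)
    own : cnt f (f x) x ≤ cnt g (f x) x
    own = cnt-mono λ {w} e fw → trans (g-off (¬-not λ Sw →
      apart val Sx (proj₂ (∖-⊆ S {x} {w} Sw)) e (≡-sym fw))) fw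
    extend : (∃ λ d → d ∈ L x × d ≢ f x × cnt f d x ≤ 2 × cnt g d x ≤ 2) → ∃ (Alternative f S)
    extend (d , d∈ , d≢ , few-f , few-g) = c⁺ , record
      { listed = listed⁺ ; other = other⁺ ; few = few⁺ ; proper = proper⁺ }
      where
      c⁺ = recolour c x d
      at : c⁺ x ≡ d
      at = recolour-at c x d
      off : ∀ {y} → y ≢ x → c⁺ y ≡ c y
      off = recolour-off c x d
      S₁⁺ : ∀ {y} → y ≢ x → S y ≡ true → S₁ y ≡ true
      S₁⁺ {y} y≢x Sy = trans (updateAt-minimal y x S y≢x) Sy
      listed⁺ : ∀ {y} → S y ≡ true → c⁺ y ∈ L y
      listed⁺ {y} Sy with y ≟F x
      ... | yes refl = subst (_∈ L x) (≡-sym at) d∈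
      ... | no y≢x   = subst (_∈ L y) (≡-sym (off y≢x)) (listed alt (S₁⁺ y≢x Sy))
      other⁺ : ∀ {y} → S y ≡ true → c⁺ y ≢ f y
      other⁺ {y} Sy with y ≟F x
      ... | yes refl = subst (_≢ f x) (≡-sym at) d≢
      ... | no y≢x   = subst (_≢ f y) (≡-sym (off y≢x)) (other alt (S₁⁺ y≢x Sy))
      few⁺ : ∀ {y} → S y ≡ true → cnt f (c⁺ y) y ≤ 2
      few⁺ {y} Sy with y ≟F x
      ... | yes refl = subst (λ b → cnt f b x ≤ 2) (≡-sym at) few-f
      ... | no y≢x   = subst (λ b → cnt f b y ≤ 2) (≡-sym (off y≢x)) (few alt (S₁⁺ y≢x Sy))
      -- A neighbour y of x moved to d would be a third neighbour of x coloured d in g.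
      fresh : ∀ {y} → y ≢ x → S y ≡ true → E x y ≡ true → c y ≢ d
      fresh {y} y≢x Sy e cy = <⇒≱ (≤-trans (s≤s f≥2) (cnt-strict y same e fy≢d gy)) few-g
        where
        f≥2 : 2 ≤ cnt f d x
        f≥2 = ≤-trans (heavy val Sx) (own-≤ m d∈)
        out : ∀ {w} → E x w ≡ true → f w ≡ d → S w ≡ false
        out = alternative-outside m val (heavy val Sx) d∈ d≢ few-f
        same : ∀ {w} → E x w ≡ true → f w ≡ d → g w ≡ d
        same {w} e fw = trans (g-off (¬-not λ Sw →
          contradiction (trans (≡-sym (proj₂ (∖-⊆ S {x} {w} Sw))) (out e fw)) λ ())) fw
        fy≢d : f y ≢ d
        fy≢d fy = contradiction (trans (≡-sym Sy) (out e fy)) λ ()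
        gy : g y ≡ d
        gy rewrite S₁⁺ y≢x Sy = cy
      proper⁺ : ∀ {y z} → S y ≡ true → S z ≡ true → E y z ≡ true → c⁺ y ≢ c⁺ z
      proper⁺ {y} {z} Sy Sz e with y ≟F x | z ≟F x
      ... | yes refl | yes refl = contradiction (trans (≡-sym e) (irrefl G x)) λ ()
      ... | yes refl | no z≢x   = λ eq → fresh z≢x Sz e (trans (≡-sym (off z≢x)) (trans (≡-sym eq) at))
      ... | no y≢x   | yes refl = λ eq → fresh y≢x Sy (E-sym e) (trans (≡-sym (off y≢x)) (trans eq at))
      ... | no y≢x   | no z≢x   = λ eq → proper alt (S₁⁺ y≢x Sy) (S₁⁺ z≢x Sz) e
                                    (trans (≡-sym (off y≢x)) (trans eq (off z≢x)))

  bools : List Bool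
  bools = false ∷ true ∷ []

  ∈-bools : ∀ b → b ∈ bools
  ∈-bools false = here refl
  ∈-bools true  = there (here refl)

  Valid-∪ : ∀ {f S a} → Valid f S → 2 ≤ cnt f (f a) a →
    (∀ {y} → S y ≡ true → E a y ≡ true → f a ≢ f y) → Valid f (S ∪｛ a ｝)
  Valid-∪ {f} {S} {a} val ha free-a = record { heavy = heavy⁺ ; apart = apart⁺ }
    where
    old : ∀ {x} → x ≢ a → (S ∪｛ a ｝) x ≡ true → S x ≡ true
    old {x} x≢a Sx = trans (≡-sym (updateAt-minimal x a S x≢a)) Sx
    heavy⁺ : ∀ {x} → (S ∪｛ a ｝) x ≡ true → 2 ≤ cnt f (f x) x
    heavy⁺ {x} Sx with x ≟F a
    ... | yes refl = ha
    ... | no x≢a   = heavy val (old x≢a Sx)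
    apart⁺ : ∀ {x y} → (S ∪｛ a ｝) x ≡ true → (S ∪｛ a ｝) y ≡ true → E x y ≡ true → f x ≢ f y
    apart⁺ {x} {y} Sx Sy e with x ≟F a | y ≟F a
    ... | yes refl | yes refl = contradiction (trans (≡-sym e) (irrefl G a)) λ ()
    ... | yes refl | no y≢a   = free-a (old y≢a Sy) e
    ... | no x≢a   | yes refl = free-a (old x≢a Sx) (E-sym e) ∘ ≡-sym
    ... | no x≢a   | no y≢a   = apart val (old x≢a Sx) (old y≢a Sy) e

  -- Nodes outside `S`, and their contacts with both colours of the vertices in `S`.

  module Flexible (f : V → ℕ) (S : V → Bool) (c : V → ℕ)
                  (min : Minimal f) (val : Valid f S) (alt : Alternative f S c)
                  (largest : ∀ {g S′} → Minimal g → Valid g S′ → card S′ ≤ card S) where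

    S-disjoint : ∀ {x y} → S x ≡ true → S y ≡ false → x ≢ y
    S-disjoint Sx Sy refl = contradiction (trans (≡-sym Sx) Sy) λ ()

    colour : V → Bool → ℕ
    colour s b = if b then c s else f s

    -- `flexible` counts a vertex of `S` as soon as one of its two colours is that of `v`, whichever
    -- of them it finally receives.
    data Touches (v w : V) : Set where
      fixed    : S w ≡ false → f w ≡ f v → Touches v w
      flexible : S w ≡ true → ∀ b → colour w b ≡ f v → Touches v w

    -- All vertices touching v get the colour of v in one and the same recolouring.
    touches≤2 : ∀ {v x y z} → S v ≡ false → x ≢ y → x ≢ z → y ≢ z → E v x ≡ true → Touches v x →
      E v y ≡ true → Touches v y → E v z ≡ true → Touches v z → ⊥
    touches≤2 {v} Sv xy xz yz ex tx ey ty ez tz =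
      cnt≤2 (subst (λ d → cnt g d v ≤ 2) gv (own≤2 (Mixed-Minimal min val alt mix) v))
        xy xz yz ex (attains tx) ey (attains ty) ez (attains tz)
      where
      g : V → ℕ
      g w = if S w ∧ does (c w ≟ f v) then c w else f w
      mix : Mixed f S c g
      mix w with S w
      ... | false = inj₁ refl
      ... | true with does (c w ≟ f v)
      ...   | true  = inj₂ (refl , refl)
      ...   | false = inj₁ refl
      gv : g v ≡ f v
      gv rewrite Sv = refl
      attains : ∀ {w} → Touches v w → g w ≡ f v
      attains (fixed Sw fw) rewrite Sw = fw
      attains {w} (flexible Sw true cw) rewrite Sw | dec-true (c w ≟ f v) cw = cw
      attains {w} (flexible Sw false fw)
        rewrite Sw | dec-false (c w ≟ f v) (λ cw → other alt Sw (trans cw (≡-sym fw))) = fw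

    Mate : V → V → Set
    Mate u w = S w ≡ false × E u w ≡ true × f w ≡ f u

    -- A vertex with two mates could be added to `S`: a neighbour of its colour in `S` would be a
    -- third vertex touching it.
    mate-unique : ∀ {u w w′} → S u ≡ false → Mate u w → Mate u w′ → w ≡ w′
    mate-unique {u} {w} {w′} Su (Sw , e , fw) (Sw′ , e′ , fw′) with w ≟F w′
    ... | yes eq = eq
    ... | no w≢w′ = contradiction (largest min larger) (<⇒≱ (subst (card S <_) (≡-sym (card-∪ S u Su)) (n<1+n _)))
      where
      larger : Valid f (S ∪｛ u ｝)
      larger = Valid-∪ val (cnt≥2 w≢w′ e fw e′ fw′) λ Sy ey fu → touches≤2 Su
        (S-disjoint Sy Sw) (S-disjoint Sy Sw′) w≢w′ ey (flexible Sy false (≡-sym fu)) e (fixed Sw fw) e′ (fixed Sw′ fw′)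

    -- Outside `S` this means lying in the same node. As nodes have at most two vertices, it is
    -- transitive there.
    Near : V → V → Set
    Near u w = u ≡ w ⊎ (E u w ≡ true × f w ≡ f u)

    near? : ∀ u w → Dec (Near u w)
    near? u w = (u ≟F w) ⊎-dec ((E u w ≟B true) ×-dec (f w ≟ f u))

    near-sym : ∀ {u w} → Near u w → Near w u
    near-sym (inj₁ eq)       = inj₁ (≡-sym eq)
    near-sym (inj₂ (e , fw)) = inj₂ (E-sym e , ≡-sym fw)

    near-trans : ∀ {u w w′} → S u ≡ false → S w ≡ false → S w′ ≡ false → Near u w → Near u w′ → Near w w′
    near-trans Su Sw Sw′ (inj₁ refl) near = near
    near-trans Su Sw Sw′ near (inj₁ refl) = near-sym near
    near-trans Su Sw Sw′ (inj₂ (e , fw)) (inj₂ (e′ , fw′)) = inj₁ (mate-unique Su (Sw , e , fw) (Sw′ , e′ , fw′))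

    colour-≤2 : ∀ {s} → S s ≡ true → ∀ b → cnt f (colour s b) s ≤ 2
    colour-≤2 Ss true  = few alt Ss
    colour-≤2 Ss false = own≤2 min _

    colour-≥2 : ∀ {s} → S s ≡ true → ∀ b → 2 ≤ cnt f (colour s b) s
    colour-≥2 Ss true  = ≤-trans (heavy val Ss) (own-≤ min (listed alt Ss))
    colour-≥2 Ss false = heavy val Ss

    record Ends (s : V) (b : Bool) (end : Bool → V) : Set where
      field
        distinct : end false ≢ end true
        adjacent : ∀ i → E s (end i) ≡ true
        coloured : ∀ i → f (end i) ≡ colour s b
    open Ends

    opaque
      -- The two neighbours of `s` in one of its colours; by `colour-≤2` there are no others.
      -- Outside `S` the constant `s` is a dummy value.
      ends : ∀ s b → ∃ λ end → S s ≡ true → Ends s b end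
      ends s b with S s ≟B true
      ... | no Ss≢ = (λ _ → s) , λ Ss → contradiction Ss Ss≢
      ... | yes Ss with pick-nbrs f (colour s b) s (colour-≥2 Ss b)
      ...   | p , q , p≢q , (ep , fp) , (eq , fq) = (λ i → if i then q else p) , λ _ → record
              { distinct = p≢q
              ; adjacent = λ { true → eq ; false → ep }
              ; coloured = λ { true → fq ; false → fp } }

    end : V → Bool → Bool → V
    end s b = proj₁ (ends s b)

    module _ {s : V} (Ss : S s ≡ true) (b : Bool) where

      end-ok : Ends s b (end s b)
      end-ok = proj₂ (ends s b) Ss

      end-outside : ∀ i → S (end s b i) ≡ false
      end-outside i = outside b (adjacent end-ok i) (coloured end-ok i)
        where
        outside : ∀ b {u} → E s u ≡ true → f u ≡ colour s b → S u ≡ false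
        outside true  e fu = alternative-outside min val (heavy val Ss) (listed alt Ss) (other alt Ss) (few alt Ss) e fu
        outside false e fu = ¬-not λ Su → apart val Ss Su e (≡-sym fu)

      end-injective : ∀ {i j} → end s b i ≡ end s b j → i ≡ j
      end-injective {false} {false} _  = refl
      end-injective {true}  {true}  _  = refl
      end-injective {false} {true}  eq = contradiction eq (distinct end-ok)
      end-injective {true}  {false} eq = contradiction (≡-sym eq) (distinct end-ok)

      end-complete : ∀ {w} → E s w ≡ true → f w ≡ colour s b → ∃ λ i → w ≡ end s b i
      end-complete {w} e fw with w ≟F end s b false | w ≟F end s b true
      ... | yes eq | _      = false , eq
      ... | no _   | yes eq = true , eq
      ... | no w≢p | no w≢q = ⊥-elim (cnt≤2 (colour-≤2 Ss b) w≢p w≢q (distinct end-ok) e fw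
              (adjacent end-ok false) (coloured end-ok false) (adjacent end-ok true) (coloured end-ok true))

      end-touches : ∀ i → Touches (end s b i) s
      end-touches i = flexible Ss b (≡-sym (coloured end-ok i))

    -- The paths and cycles formed by the literals.

    open Assignment {n G} using (Literal)
    open Orientation {Literal} (≡-dec _≟F_ _≟B_) using (Dart; Matching; module Matching; Orients; orientation)

    tip : Dart → V
    tip ((s , b) , i) = end s b i

    owner : Dart → V
    owner ((s , _) , _) = s

    -- Requiring different owners keeps a vertex with both ends in one node from being linked to
    -- itself, which gives irreflexivity of `link` and `right-irrefl`.
    Linked : Dart → Dart → Set
    Linked d e = S (owner d) ≡ true × S (owner e) ≡ true × owner d ≢ owner e × Near (tip d) (tip e)

    linked? : ∀ d e → Dec (Linked d e)
    linked? d e = (S (owner d) ≟B true) ×-dec (S (owner e) ≟B true) ×-dec ¬? (owner d ≟F owner e) ×-dec near? (tip d) (tip e)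

    linked-sym : ∀ {d e} → Linked d e → Linked e d
    linked-sym (Sd , Se , d≢e , near) = Se , Sd , d≢e ∘ ≡-sym , near-sym near

    tip-injective : ∀ {d e} → S (owner d) ≡ true → owner d ≡ owner e → tip d ≡ tip e → d ≡ e
    tip-injective {(s , b) , i} {(.s , b′) , j} Ss refl eq with b ≟B b′
    ... | yes refl = cong ((s , b) ,_) (end-injective Ss b eq)
    ... | no b≢b′ = contradiction (trans (≡-sym (coloured (end-ok Ss b) i))
            (trans (cong f eq) (coloured (end-ok Ss b′) j))) (clash b b′ b≢b′)
      where
      clash : ∀ b b′ → b ≢ b′ → colour s b ≢ colour s b′
      clash false false ne = contradiction refl ne
      clash true  true  ne = contradiction refl ne
      clash true  false ne = other alt Ss
      clash false true  ne = other alt Ss ∘ ≡-sym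

    -- If `e` and `e′` differed in tip or owner, some vertex of the shared node would have three
    -- touching neighbours or two mates. With tip and owner equal, the colour of the tip determines
    -- the literal.
    linked-unique : ∀ {d e e′} → Linked d e → Linked d e′ → e ≡ e′
    linked-unique {d@((s , b) , i)} {e@((t , b₁) , j₁)} {e′@((t′ , b₂) , j₂)} (Sd , Se , d≢e , near) (_ , Se′ , d≢e′ , near′) =
      tip-injective Se (same-owner near near′) (same-tip near near′)
      where
      Su : S (tip d) ≡ false
      Su = end-outside Sd b i
      Sw : S (tip e) ≡ false
      Sw = end-outside Se b₁ j₁
      Sw′ : S (tip e′) ≡ false
      Sw′ = end-outside Se′ b₂ j₂
      toward : ∀ {r} (Sr : S r ≡ true) b i {u} → u ≡ end r b i → E u r ≡ true × Touches u r
      toward Sr b i refl = E-sym (adjacent (end-ok Sr b) i) , end-touches Sr b i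
      one-sided : ∀ {r b j w} → S r ≡ true → s ≢ r → tip d ≡ end r b j → S w ≡ false →
        E (tip d) w ≡ true → f w ≡ f (tip d) → ⊥
      one-sided Sr s≢r eq Sw ew fw = touches≤2 Su s≢r (S-disjoint Sd Sw) (S-disjoint Sr Sw)
        (E-sym (adjacent (end-ok Sd b) i)) (end-touches Sd b i)
        (proj₁ (toward Sr _ _ eq)) (proj₂ (toward Sr _ _ eq)) ew (fixed Sw fw)
      same-tip : Near (tip d) (tip e) → Near (tip d) (tip e′) → tip e ≡ tip e′
      same-tip (inj₁ eq) (inj₁ eq′) = trans (≡-sym eq) eq′
      same-tip (inj₁ eq) (inj₂ (ew , fw)) = ⊥-elim (one-sided Se d≢e eq Sw′ ew fw)
      same-tip (inj₂ (ew , fw)) (inj₁ eq) = ⊥-elim (one-sided Se′ d≢e′ eq Sw ew fw)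
      same-tip (inj₂ (ew , fw)) (inj₂ (ew′ , fw′)) = mate-unique Su (Sw , ew , fw) (Sw′ , ew′ , fw′)
      same-owner : Near (tip d) (tip e) → Near (tip d) (tip e′) → t ≡ t′
      same-owner near near′ with t ≟F t′
      ... | yes eq = eq
      ... | no t≢t′ = ⊥-elim (three near near′)
        where
        eq = same-tip near near′
        at-e′ = toward Se′ b₂ j₂ eq
        three : Near (tip d) (tip e) → Near (tip d) (tip e′) → ⊥
        three (inj₁ u≡) _ = touches≤2 Sw d≢e d≢e′ t≢t′
          (proj₁ (toward Sd b i (≡-sym u≡))) (proj₂ (toward Sd b i (≡-sym u≡)))
          (E-sym (adjacent (end-ok Se b₁) j₁)) (end-touches Se b₁ j₁) (proj₁ at-e′) (proj₂ at-e′)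
        three (inj₂ (eu , fu)) _ = touches≤2 Sw (S-disjoint Se Su) t≢t′ (S-disjoint Se′ Su ∘ ≡-sym)
          (E-sym (adjacent (end-ok Se b₁) j₁)) (end-touches Se b₁ j₁)
          (E-sym eu) (fixed Su (≡-sym fu)) (proj₁ at-e′) (proj₂ at-e′)

    items : List Literal
    items = cartesianProduct (allFin (n G)) bools

    darts : List Dart
    darts = cartesianProduct items bools

    ∈-items : ∀ ℓ → ℓ ∈ items
    ∈-items (s , b) = ∈-cartesianProduct⁺ (∈-allFin s) (∈-bools b)

    ∈-darts : ∀ d → d ∈ darts
    ∈-darts (ℓ , i) = ∈-cartesianProduct⁺ (∈-items ℓ) (∈-bools i)

    opaque
      link : Dart → Maybe Dart
      link d with any? (linked? d) darts
      ... | yes found = just (proj₁ (find found))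
      ... | no _      = nothing

      link-sound : ∀ {d e} → link d ≡ just e → Linked d e
      link-sound {d} eq with any? (linked? d) darts
      link-sound {d} refl | yes found = proj₂ (proj₂ (find found))

      link-complete : ∀ {d e} → Linked d e → link d ≡ just e
      link-complete {d} {e} l with any? (linked? d) darts
      ... | yes found = cong just (linked-unique (proj₂ (proj₂ (find found))) l)
      ... | no none   = contradiction (lose (∈-darts e) l) none

    link-matching : Matching link items
    link-matching = record
      { symmetric   = λ eq → link-complete (linked-sym (link-sound eq))
      ; irreflexive = λ eq → proj₁ (proj₂ (proj₂ (link-sound eq))) refl
      ; within      = λ _ → ∈-items _ }

    opaque
      oriented-links : ∃ (Orients link)
      oriented-links = orientation items link-matching

    right-end : Literal → Bool
    right-end = proj₁ oriented-links

    oriented : Orients link right-end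
    oriented = proj₂ oriented-links

    -- The end selected by `right-end` is on side `false`, the opposite end on side `true`. So every
    -- link runs from a right end to a left end.
    right left : Literal → Maybe Literal
    right ℓ = mapMaybe proj₁ (link (ℓ , right-end ℓ))
    left ℓ  = mapMaybe proj₁ (link (ℓ , not (right-end ℓ)))

    via : ∀ {d ℓ} → mapMaybe proj₁ (link d) ≡ just ℓ → ∃ λ i → link d ≡ just (ℓ , i)
    via {d} eq with link d
    via refl | just (ℓ , i) = i , refl

    left⇒right : ∀ {ℓ k} → left ℓ ≡ just k → right k ≡ just ℓ
    left⇒right {ℓ} {k} eq with via eq
    ... | i , eq′ = trans (cong (λ j → mapMaybe proj₁ (link (k , j))) (≡-sym (sides (right-end ℓ) (right-end k) i (oriented eq′))))
                      (cong (mapMaybe proj₁) (Matching.symmetric link-matching eq′))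
      where
      sides : ∀ a b i → a xor not a ≡ not (b xor i) → i ≡ b
      sides _     true  true  _  = refl
      sides _     false false _  = refl
      sides true  true  false ()
      sides false true  false ()
      sides true  false true  ()
      sides false false true  ()

    right-irrefl : ∀ {ℓ} → right ℓ ≢ just ℓ
    right-irrefl eq with via eq
    ... | _ , eq′ = proj₁ (proj₂ (proj₂ (link-sound eq′))) refl

    -- The recolouring `g` given by the truth assignment.

    opaque
      assignment : ∃ λ (a : V → Bool) → ∀ {x r k} → right (x , a x) ≡ just r → left (x , a x) ≡ just k →
        a (proj₁ r) ≡ proj₂ r → a (proj₁ k) ≢ proj₂ k
      assignment = Assignment.no-three-consecutive right left left⇒right right-irrefl

    a : V → Bool
    a = proj₁ assignment

    opaque
      g : V → ℕ
      g v = if S v then colour v (a v) else f v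

      g-in : ∀ {s} → S s ≡ true → g s ≡ colour s (a s)
      g-in Ss rewrite Ss = refl

      g-out : ∀ {v} → S v ≡ false → g v ≡ f v
      g-out Sv rewrite Sv = refl

      g-mixed : Mixed f S c g
      g-mixed w with S w | a w
      ... | false | _     = inj₁ refl
      ... | true  | false = inj₁ refl
      ... | true  | true  = inj₂ (refl , refl)

    g-minimal : Minimal g
    g-minimal = Mixed-Minimal min val alt g-mixed

    Same : V → V → Set
    Same u w = E u w ≡ true × g w ≡ g u

    same-sym : ∀ {u w} → Same u w → Same w u
    same-sym (e , gw) = E-sym e , ≡-sym gw

    same≤2 : ∀ {v x y z} → x ≢ y → x ≢ z → y ≢ z → Same v x → Same v y → Same v z → ⊥
    same≤2 {v} xy xz yz (ex , gx) (ey , gy) (ez , gz) = cnt≤2 (own≤2 g-minimal v) xy xz yz ex gx ey gy ez gz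

    top : V → Bool → V
    top s = end s (a s)

    module _ {s : V} (Ss : S s ≡ true) where

      top-outside : ∀ i → S (top s i) ≡ false
      top-outside = end-outside Ss (a s)

      top-same : ∀ i → Same s (top s i)
      top-same i = adjacent (end-ok Ss (a s)) i ,
        trans (g-out (top-outside i)) (trans (coloured (end-ok Ss (a s)) i) (≡-sym (g-in Ss)))

      top-complete : ∀ {w} → S w ≡ false → Same s w → ∃ λ i → w ≡ top s i
      top-complete Sw (e , gw) = end-complete Ss (a s) e (trans (≡-sym (g-out Sw)) (trans gw (g-in Ss)))

    -- This allows exchanges to be carried out in `g`, since `largest` compares `S` with valid sets
    -- of every minimal colouring. A second colour meeting a first colour is excluded by
    -- `alternative-outside`.
    g-valid : Valid g S
    g-valid = record
      { heavy = λ {s} Ss → cnt≥2 {g} (distinct (end-ok Ss (a s))) (proj₁ (top-same Ss false)) (proj₂ (top-same Ss false))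
                             (proj₁ (top-same Ss true)) (proj₂ (top-same Ss true))
      ; apart = λ {x} {y} Sx Sy e eq → clash (a x) (a y) Sx Sy e
                  (trans (≡-sym (g-in Sx)) (trans eq (g-in Sy))) }
      where
      clash : ∀ b b′ {x y} → S x ≡ true → S y ≡ true → E x y ≡ true → colour x b ≢ colour y b′
      clash true  true  Sx Sy e eq = proper alt Sx Sy e eq
      clash false false Sx Sy e eq = apart val Sx Sy e eq
      clash true  false Sx Sy e eq = contradiction (trans (≡-sym Sy)
        (alternative-outside min val (heavy val Sx) (listed alt Sx) (other alt Sx) (few alt Sx) e (≡-sym eq))) λ ()
      clash false true  Sx Sy e eq = contradiction (trans (≡-sym Sx)
        (alternative-outside min val (heavy val Sy) (listed alt Sy) (other alt Sy) (few alt Sy) (E-sym e) eq)) λ ()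

    same-outside : ∀ {u w} → S u ≡ false → S w ≡ false → Same u w → Near u w
    same-outside Su Sw (e , gw) = inj₂ (e , trans (≡-sym (g-out Sw)) (trans gw (g-out Su)))

    mate-same : ∀ {u w} → S u ≡ false → Mate u w → Same u w
    mate-same Su (Sw , e , fw) = e , trans (g-out Sw) (trans fw (≡-sym (g-out Su)))

    -- t and s, in their colours under g, share the node of the i-th end of t and the j-th end of s.
    Meets : V → Bool → V → Bool → Set
    Meets t i s j = Linked ((t , a t) , i) ((s , a s) , j)

    -- The literals chosen at `t`, `s` and `r` are all true, and those of `s` and `r` would be the
    -- neighbours of that of `t` on its two sides.
    meets-one-end : ∀ {t s r j k} → Meets t false s j → Meets t true r k → ⊥
    meets-one-end {t} {s} {r} {j} {k} m₀ m₁ = by-right (right-end (t , a t)) refl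
      where
      good = proj₂ assignment
      at : ∀ {i x l} → Meets t i x l → mapMaybe proj₁ (link ((t , a t) , i)) ≡ just (x , a x)
      at m = cong (mapMaybe proj₁) (link-complete m)
      rewire : ∀ {i i′ ℓ} → i ≡ i′ → mapMaybe proj₁ (link ((t , a t) , i)) ≡ just ℓ →
        mapMaybe proj₁ (link ((t , a t) , i′)) ≡ just ℓ
      rewire refl eq = eq
      by-right : ∀ b → right-end (t , a t) ≡ b → ⊥
      by-right false eq = good (rewire (≡-sym eq) (at m₀)) (rewire (cong not (≡-sym eq)) (at m₁)) refl refl
      by-right true  eq = good (rewire (≡-sym eq) (at m₁)) (rewire (cong not (≡-sym eq)) (at m₀)) refl refl

    -- Exchanges that would enlarge `S`.

    ∪-keep : ∀ {p : V → Bool} {u x} → x ≢ u → p x ≡ false → (p ∪｛ u ｝) x ≡ false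
    ∪-keep {p} {u} {x} x≢u px = trans (updateAt-minimal x u p x≢u) px

    ∖-keep : ∀ {p : V → Bool} {u x} → p x ≡ false → (p ∖｛ u ｝) x ≡ false
    ∖-keep {p} {u} {x} px = ¬-not λ eq → contradiction (trans (≡-sym (proj₂ (∖-⊆ p {u} {x} eq))) px) λ ()

    ∖-gone : ∀ (p : V → Bool) u → (p ∖｛ u ｝) u ≡ false
    ∖-gone p u = updateAt-updates u p

    -- By `same≤2`, `x` and `y` are all the neighbours of `u` in its colour; both being outside
    -- `S′`, nothing in `S′` conflicts with `u`.
    enlarge : ∀ {S′ u x y} → Valid g S′ → x ≢ y → Same u x → Same u y → S′ x ≡ false → S′ y ≡ false →
      Valid g (S′ ∪｛ u ｝)
    enlarge {S′} {u} {x} {y} v x≢y sx sy S′x S′y =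
      Valid-∪ v (cnt≥2 x≢y (proj₁ sx) (proj₂ sx) (proj₁ sy) (proj₂ sy)) λ {z} S′z e gu →
        same≤2 x≢y (avoid S′z S′x) (avoid S′z S′y) sx sy (e , ≡-sym gu)
      where
      avoid : ∀ {z w} → S′ z ≡ true → S′ w ≡ false → w ≢ z
      avoid S′z S′w refl = contradiction (trans (≡-sym S′z) S′w) λ ()

    -- Otherwise the two ends could replace t in S.
    one-mate : ∀ {t w w′} → S t ≡ true → ¬ Near (top t false) (top t true) →
      Mate (top t false) w → Mate (top t true) w′ → ⊥
    one-mate {t} {w} {w′} St far mw@(Sw , _) mw′@(Sw′ , _) = <⇒≱ bigger (largest g-minimal valid₂)
      where
      p = top t false
      q = top t true
      Sp = top-outside St false
      Sq = top-outside St true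
      S₀ = S ∖｛ t ｝
      S₁ = S₀ ∪｛ p ｝
      S₂ = S₁ ∪｛ q ｝
      p≢q : p ≢ q
      p≢q = distinct (end-ok St (a t))
      w′≢p : w′ ≢ p
      w′≢p refl = far (near-sym (inj₂ (proj₂ mw′)))
      valid₁ : Valid g S₁
      valid₁ = enlarge (Valid-∖ g-valid) (S-disjoint St Sw) (same-sym (top-same St false)) (mate-same Sp mw)
        (∖-gone S t) (∖-keep {S} Sw)
      valid₂ : Valid g S₂
      valid₂ = enlarge valid₁ (S-disjoint St Sw′) (same-sym (top-same St true)) (mate-same Sq mw′)
        (∪-keep {S₀} (S-disjoint St Sp) (∖-gone S t)) (∪-keep {S₀} w′≢p (∖-keep {S} Sw′))
      bigger : card S < card S₂
      bigger = ≤-reflexive (begin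
        suc (card S)        ≡⟨ cong suc (card-∖ S t St) ⟩
        suc (suc (card S₀)) ≡⟨ cong suc (card-∪ S₀ p (∖-keep {S} Sp)) ⟨
        suc (card S₁)       ≡⟨ card-∪ S₁ q (∪-keep {S₀} (p≢q ∘ ≡-sym) (∖-keep {S} Sq)) ⟨
        card S₂             ∎)
        where open ≡-Reasoning

    -- Otherwise each of the three nodes could contribute a vertex to S, in place of t and s.
    no-outer-mates : ∀ {t s i j w w′} → Meets t i s j → top t i ≡ top s j →
      ¬ Near (top t (not i)) (top s (not j)) → Mate (top t (not i)) w → Mate (top s (not j)) w′ → ⊥
    no-outer-mates {t} {s} {i} {j} {w} {w′} (St , Ss , t≢s , _) same far mw@(Sw , _) mw′@(Sw′ , _) =
      <⇒≱ bigger (largest g-minimal valid₃)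
      where
      p = top t (not i)
      q = top s (not j)
      m = top t i
      Sp = top-outside St (not i)
      Sq = top-outside Ss (not j)
      Sm = top-outside St i
      S₀ = (S ∖｛ t ｝) ∖｛ s ｝
      S₁ = S₀ ∪｛ p ｝
      S₂ = S₁ ∪｛ q ｝
      S₃ = S₂ ∪｛ m ｝
      keep₀ : ∀ {x} → S x ≡ false → S₀ x ≡ false
      keep₀ Sx = ∖-keep {S ∖｛ t ｝} (∖-keep {S} Sx)
      m≢p : m ≢ p
      m≢p eq = not-¬ refl (end-injective St (a t) eq)
      m≢q : m ≢ q
      m≢q eq = not-¬ refl (end-injective Ss (a s) (trans (≡-sym same) eq))
      q≢p : q ≢ p
      q≢p eq = far (inj₁ (≡-sym eq))
      w′≢p : w′ ≢ p
      w′≢p refl = far (near-sym (inj₂ (proj₂ mw′)))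
      St₁ : S₁ t ≡ false
      St₁ = ∪-keep {S₀} (S-disjoint St Sp) (∖-keep {S ∖｛ t ｝} (∖-gone S t))
      Ss₁ : S₁ s ≡ false
      Ss₁ = ∪-keep {S₀} (S-disjoint Ss Sp) (∖-gone (S ∖｛ t ｝) s)
      valid₁ : Valid g S₁
      valid₁ = enlarge (Valid-∖ (Valid-∖ g-valid)) (S-disjoint St Sw) (same-sym (top-same St (not i))) (mate-same Sp mw)
        (∖-keep {S ∖｛ t ｝} (∖-gone S t)) (keep₀ Sw)
      valid₂ : Valid g S₂
      valid₂ = enlarge valid₁ (S-disjoint Ss Sw′) (same-sym (top-same Ss (not j))) (mate-same Sq mw′)
        Ss₁ (∪-keep {S₀} w′≢p (keep₀ Sw′))
      valid₃ : Valid g S₃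
      valid₃ = enlarge valid₂ t≢s (same-sym (top-same St i))
        (same-sym (subst (Same s) (≡-sym same) (top-same Ss j)))
        (∪-keep {S₁} (S-disjoint St Sq) St₁) (∪-keep {S₁} (S-disjoint Ss Sq) Ss₁)
      bigger : card S < card S₃
      bigger = ≤-reflexive (begin
        suc (card S)              ≡⟨ cong suc (card-∖ S t St) ⟩
        suc (suc (card (S ∖｛ t ｝))) ≡⟨ cong (λ k → suc (suc k)) (card-∖ (S ∖｛ t ｝) s
                                         (trans (updateAt-minimal s t S (t≢s ∘ ≡-sym)) Ss)) ⟩
        suc (suc (suc (card S₀))) ≡⟨ cong (λ k → suc (suc k)) (card-∪ S₀ p (keep₀ Sp)) ⟨
        suc (suc (card S₁))       ≡⟨ cong suc (card-∪ S₁ q (∪-keep {S₀} q≢p (keep₀ Sq))) ⟨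
        suc (card S₂)             ≡⟨ card-∪ S₂ m (∪-keep {S₁} m≢q (∪-keep {S₀} m≢p (keep₀ Sm))) ⟨
        card S₃                   ∎)
        where open ≡-Reasoning

    -- Covering each component by at most six vertices.

    mate? : ∀ u → Dec (∃ (Mate u))
    mate? u = anyF? λ w → (S w ≟B false) ×-dec (E u w ≟B true) ×-dec (f w ≟ f u)

    node : V → List V
    node u with mate? u
    ... | yes (w , _) = u ∷ w ∷ []
    ... | no _        = u ∷ []

    near∈node : ∀ {u w} → S u ≡ false → S w ≡ false → Near u w → w ∈ node u
    near∈node {u} {w} Su Sw near with mate? u
    near∈node Su Sw (inj₁ refl) | yes _ = here refl
    near∈node Su Sw (inj₁ refl) | no _  = here refl
    near∈node Su Sw (inj₂ e) | yes (_ , m) = there (here (mate-unique Su (Sw , e) m))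
    near∈node {w = w} Su Sw (inj₂ e) | no none = contradiction (w , Sw , e) none

    node-length : ∀ u → length (node u) ≤ 2
    node-length u with mate? u
    ... | yes _ = ≤-refl
    ... | no _  = s≤s z≤n

    Closed : (V → Set) → Set
    Closed P = ∀ {x y} → P x → Same x y → P y

    -- A set containing `v` and closed under monochromatic edges contains its component, so it
    -- suffices to list such a set.
    record Cover (v : V) : Set₁ where
      field
        P      : V → Set
        start  : P v
        closed : Closed P
        list   : List V
        covers : ∀ {y} → P y → y ∈ list
        length≤6 : length list ≤ 6

    data Region (ts : List V) (y : V) : Set where
      centre : y ∈ ts → Region ts y
      around : ∀ {t} → t ∈ ts → ∀ i → S y ≡ false → Near (top t i) y → Region ts y

    -- From a centre, a monochromatic edge leads to one of its ends, since `S` is valid for `g`.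
    -- From a node it stays inside or leads to a vertex of `S` with an end there: `t` itself or a
    -- vertex that `t` meets.
    region-closed : ∀ {ts} → (∀ {t} → t ∈ ts → S t ≡ true) →
      (∀ {t i s j} → t ∈ ts → Meets t i s j → s ∈ ts) → Closed (Region ts)
    region-closed inS meets {x} {y} (centre x∈) same with S y in Sy
    ... | true  = contradiction (≡-sym (proj₂ same)) (apart g-valid (inS x∈) Sy (proj₁ same))
    ... | false with top-complete (inS x∈) Sy same
    ...   | i , eq = around x∈ i Sy (inj₁ (≡-sym eq))
    region-closed inS meets {x} {y} (around {t} t∈ i Sx near) same with S y in Sy
    ... | false = around t∈ i Sy (near-trans Sx (top-outside (inS t∈) i) Sy (near-sym near) (same-outside Sx Sy same))
    ... | true with y ≟F t | top-complete Sy Sx (same-sym same)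
    ...   | yes refl | _      = centre t∈
    ...   | no y≢t   | j , eq = centre (meets t∈ (inS t∈ , Sy , y≢t ∘ ≡-sym , subst (Near (top t i)) eq near))

    meets? : ∀ t i → Dec (∃₂ λ s j → Meets t i s j)
    meets? t i with any? (λ (s , j) → linked? ((t , a t) , i) ((s , a s) , j)) items
    ... | yes found = yes (let (s , j) , _ , m = find found in s , j , m)
    ... | no none   = no λ (s , j , m) → none (lose (∈-items (s , j)) m)

    meets-opposite : ∀ {t i s r j k} → Meets t i s j → ¬ Meets t (not i) r k
    meets-opposite {i = false} m m′ = meets-one-end m m′
    meets-opposite {i = true}  m m′ = meets-one-end m′ m

    near-mate : ∀ {u w} → S u ≡ false → Near u w → ∃ (Mate u) → ∃ (Mate w)
    near-mate Su (inj₁ refl)     m = m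
    near-mate Su (inj₂ (e , fw)) _ = _ , Su , E-sym e , ≡-sym fw

    one-mate-at : ∀ {t} i → S t ≡ true → ¬ Near (top t (not i)) (top t i) →
      ∃ (Mate (top t (not i))) → ∃ (Mate (top t i)) → ⊥
    one-mate-at false St far (_ , m) (_ , m′) = one-mate St (far ∘ near-sym) m′ m
    one-mate-at true  St far (_ , m) (_ , m′) = one-mate St far m m′

    module Pair {t s i j} (meet : Meets t i s j) where

      St : S t ≡ true
      St = proj₁ meet
      Ss : S s ≡ true
      Ss = proj₁ (proj₂ meet)
      joint : Near (top t i) (top s j)
      joint = proj₂ (proj₂ (proj₂ meet))
      p m q : V
      p = top t (not i)
      m = top t i
      q = top s (not j)

      -- If both ends of `t` lay in one node, `t` would meet `s` at both of them.
      ends-apart : ∀ {t s i j} → Meets t i s j → ¬ Near (top t (not i)) (top t i)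
      ends-apart {t} {i = i} {j} mt@(St , Ss , t≢s , near) near′ = meets-opposite mt
        (St , Ss , t≢s , near-trans (top-outside St i) (top-outside St (not i)) (top-outside Ss j) (near-sym near′) near)

      -- At most one of the three nodes has two vertices: `one-mate` excludes the middle node
      -- together with an outer one, `no-outer-mates` the two outer ones.
      total≤4 : length (node p) + (length (node m) + length (node q)) ≤ 4
      total≤4 with mate? p | mate? m | mate? q
      ... | yes mp | yes mm | _      = ⊥-elim (one-mate-at i St (ends-apart meet) mp mm)
      ... | _      | yes mm | yes mq = ⊥-elim (one-mate-at j Ss (ends-apart (linked-sym meet)) mq
                                         (near-mate (top-outside St i) joint mm))
      ... | yes (_ , mp) | no none | yes (_ , mq) = ⊥-elim (no-outer-mates meet (same joint) outer mp mq)
        where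
        -- The middle node is a single vertex here, so the ends of `t` and `s` in it coincide.
        same : Near m (top s j) → m ≡ top s j
        same (inj₁ eq) = eq
        same (inj₂ e)  = contradiction (_ , top-outside Ss j , e) none
        outer : ¬ Near p q
        outer near = meets-opposite meet (St , Ss , proj₁ (proj₂ (proj₂ meet)) , near)
      ... | yes _ | no _  | no _ = ≤-refl
      ... | no _  | yes _ | no _ = ≤-refl
      ... | no _  | no _  | yes _ = ≤-refl
      ... | no _  | no _  | no _ = s≤s (s≤s (s≤s z≤n))

      centres : ∀ {r} → r ∈ t ∷ s ∷ [] → S r ≡ true
      centres (here refl)         = St
      centres (there (here refl)) = Ss

      -- At the joint end the partner is unique by `linked-unique`; at the other end
      -- `meets-opposite` leaves none.
      meets-inside : ∀ {r k x l} → r ∈ t ∷ s ∷ [] → Meets r k x l → x ∈ t ∷ s ∷ []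
      meets-inside {k = k} (here refl) mx with k ≟B i
      ... | yes refl = there (here (cong owner (linked-unique mx meet)))
      ... | no k≢i   = contradiction (subst (λ b → Meets t b _ _) (¬-not k≢i) mx) (meets-opposite meet)
      meets-inside {k = k} (there (here refl)) mx with k ≟B j
      ... | yes refl = here (cong owner (linked-unique mx (linked-sym meet)))
      ... | no k≢j   = contradiction (subst (λ b → Meets s b _ _) (¬-not k≢j) mx) (meets-opposite (linked-sym meet))

      cover : ∀ {y} → Region (t ∷ s ∷ []) y → y ∈ t ∷ s ∷ node p ++ node m ++ node q
      cover (centre (here eq))         = here eq
      cover (centre (there (here eq))) = there (here eq)
      cover (around (here refl) k Sy near) with k ≟B i
      ... | yes refl = there (there (∈-++⁺ʳ (node p) (∈-++⁺ˡ (near∈node (top-outside St i) Sy near))))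
      ... | no k≢i rewrite ¬-not k≢i = there (there (∈-++⁺ˡ (near∈node (top-outside St (not i)) Sy near)))
      cover (around (there (here refl)) k Sy near) with k ≟B j
      ... | yes refl = there (there (∈-++⁺ʳ (node p) (∈-++⁺ˡ (near∈node (top-outside St i) Sy
                         (near-trans (top-outside Ss j) (top-outside St i) Sy (near-sym joint) near)))))
      ... | no k≢j rewrite ¬-not k≢j =
              there (there (∈-++⁺ʳ (node p) (∈-++⁺ʳ (node m) (near∈node (top-outside Ss (not j)) Sy near))))

      pair-cover : ∀ {v} → Region (t ∷ s ∷ []) v → Cover v
      pair-cover r = record
        { P = Region (t ∷ s ∷ []) ; start = r ; closed = region-closed centres meets-inside
        ; list = t ∷ s ∷ node p ++ node m ++ node q ; covers = cover
        ; length≤6 = s≤s (s≤s (subst (_≤ 4) (≡-sym (trans (length-++ (node p)) (cong (length (node p) +_) (length-++ (node m))))) total≤4)) }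

    single-cover : ∀ {v t} → S t ≡ true → (∀ i → ¬ (∃₂ λ s j → Meets t i s j)) → Region (t ∷ []) v → Cover v
    single-cover {t = t} St none r = record
      { P = Region (t ∷ []) ; start = r
      ; closed = region-closed (λ { (here refl) → St }) (λ { {i = i} {s} {j} (here refl) m → contradiction (s , j , m) (none i) })
      ; list = t ∷ node (top t false) ++ node (top t true) ; covers = cover
      ; length≤6 = s≤s (≤-trans (≤-reflexive (length-++ (node (top t false))))
                     (≤-trans (+-mono-≤ (node-length (top t false)) (node-length (top t true))) (n≤1+n 4))) }
      where
      cover : ∀ {y} → Region (t ∷ []) y → y ∈ t ∷ node (top t false) ++ node (top t true)
      cover (centre (here eq)) = here eq
      cover (around (here refl) false Sy near) = there (∈-++⁺ˡ (near∈node (top-outside St false) Sy near))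
      cover (around (here refl) true  Sy near) = there (∈-++⁺ʳ (node (top t false)) (near∈node (top-outside St true) Sy near))

    widen : ∀ {t s y} → Region (t ∷ []) y → Region (t ∷ s ∷ []) y
    widen (centre (here eq))         = centre (here eq)
    widen (around (here eq) i Sy nr) = around (here eq) i Sy nr

    around-cover : ∀ {v t} → S t ≡ true → Region (t ∷ []) v → Cover v
    around-cover {t = t} St r with meets? t false | meets? t true
    ... | yes (_ , _ , m) | _               = Pair.pair-cover m (widen r)
    ... | no _            | yes (_ , _ , m) = Pair.pair-cover m (widen r)
    ... | no none         | no none′        = single-cover St (λ { false → none ; true → none′ }) r

    component-cover : ∀ v → Cover v
    component-cover v with S v in Sv
    ... | true = around-cover Sv (centre (here refl))
    ... | false with any? (λ (t , i) → (S t ≟B true) ×-dec near? (top t i) v) items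
    ...   | yes found = let (t , i) , _ , (St , near) = find found in around-cover St (around (here refl) i Sv near)
    -- No vertex of `S` joins the node of `v` under `g`, so this node is closed by itself.
    ...   | no none = record
              { P = λ y → S y ≡ false × Near v y ; start = Sv , inj₁ refl ; closed = closed
              ; list = node v ; covers = λ (Sy , near) → near∈node Sv Sy near
              ; length≤6 = ≤-trans (node-length v) (s≤s (s≤s z≤n)) }
      where
      closed : Closed (λ y → S y ≡ false × Near v y)
      closed {x} {y} (Sx , near) same with S y in Sy
      ... | false = refl , near-trans Sx Sv Sy (near-sym near) (same-outside Sx Sy same)
      ... | true with top-complete Sy Sx (same-sym same)
      ...   | i , eq = contradiction (lose (∈-items (y , i)) (Sy , near-sym (subst (Near v) eq near))) none

    clustering : HasClustering G g 6
    clustering v us un inside = ≤-trans (unique-⊆-length un (λ u∈ → covers (reach (lookup inside u∈)))) length≤6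
      where
      open Cover (component-cover v)
      follow : ∀ {x y} → P x → Star (MonoEdge G g) x y → P y
      follow px ε = px
      follow {x} px ((e , eq) ◅ path) = follow (closed px (Equivalence.to T-≡ e , ≡-sym eq)) path
      reach : ∀ {u} → SameMonoComponent G g v u → P u
      reach = follow start

  -- Existence of an optimal colouring and set.

  valid? : ∀ f S → Dec (Valid f S)
  valid? f S = map′ (λ (h , a) → record { heavy = h _ ; apart = a _ _ }) (λ v → (λ _ → heavy v) , (λ _ _ → apart v))
    (all? (λ x → (S x ≟B true) →-dec (2 ≤? cnt f (f x) x)) ×-dec
     all? (λ x → all? λ y → (S x ≟B true) →-dec (S y ≟B true) →-dec (E x y ≟B true) →-dec ¬? (f x ≟ f y)))

  Valid-cong : ∀ {f f′ S S′} → f ≗ f′ → S ≗ S′ → Valid f S → Valid f′ S′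
  Valid-cong {f} {f′} {S} {S′} f≗ S≗ v = record
    { heavy = λ {x} Sx → subst (2 ≤_) (trans (cnt-cong f≗ (f x) x) (cong (λ d → cnt f′ d x) (f≗ x))) (heavy v (trans (S≗ x) Sx))
    ; apart = λ {x} {y} Sx Sy e eq → apart v (trans (S≗ x) Sx) (trans (S≗ y) Sy) e (trans (f≗ x) (trans eq (≡-sym (f≗ y)))) }

  Valid-∅ : ∀ {f} → Valid f (const false)
  Valid-∅ = record { heavy = λ () ; apart = λ () }

  optimum : ∃₂ λ f S → Minimal f × Valid f S × (∀ {g S′} → Minimal g → Valid g S′ → card S′ ≤ card S)
  optimum with minimiser (λ v → cartesianProduct (L v) bools) {P} P? cost inside P-resp cost-resp (h₀ , P₀)
    where
    P : (V → ℕ × Bool) → Set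
    P h = Colouring (proj₁ ∘ h) × Valid (proj₁ ∘ h) (proj₂ ∘ h)
    P? : ∀ h → Dec (P h)
    P? h = all? (λ v → proj₁ (h v) ∈? L v) ×-dec valid? (proj₁ ∘ h) (proj₂ ∘ h)
    -- A lexicographic order in one number: the second summand is at most `n G`, so the factor
    -- `suc (n G)` makes the weight decisive, and among equal weights larger sets cost less.
    cost : (V → ℕ × Bool) → ℕ
    cost h = weight (proj₁ ∘ h) * suc (n G) + (n G ∸ card (proj₂ ∘ h))
    inside : ∀ {h} → P h → ∀ v → h v ∈ cartesianProduct (L v) bools
    inside {h} (col , _) v = ∈-cartesianProduct⁺ (col v) (∈-bools (proj₂ (h v)))
    P-resp : ∀ {h h′} → h ≗ h′ → P h → P h′
    P-resp eq (col , v) = (λ u → subst (λ p → proj₁ p ∈ L u) (eq u) (col u)) , Valid-cong (cong proj₁ ∘ eq) (cong proj₂ ∘ eq) v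
    cost-resp : ∀ {h h′} → h ≗ h′ → cost h ≡ cost h′
    cost-resp eq = cong₂ (λ w s → w * suc (n G) + (n G ∸ s)) (weight-cong (cong proj₁ ∘ eq)) (card-cong (cong proj₂ ∘ eq))
    -- `L-long` rules out the empty list, its left side being positive.
    head-of : ∀ v → ∃ (_∈ L v)
    head-of v with L v | L-long v
    ... | c ∷ _ | _ = c , here refl
    h₀ : V → ℕ × Bool
    h₀ v = proj₁ (head-of v) , false
    P₀ : P h₀
    P₀ = (λ v → proj₂ (head-of v)) , Valid-∅
  ... | h , (col , v) , least = f , S , min , v , largest
    where
    f = proj₁ ∘ h
    S = proj₂ ∘ h
    N = suc (n G)
    min : Minimal f
    -- A lighter `g`, even taken with the empty set, would have smaller cost.
    min = col , λ {g} colg → ≮⇒≥ λ lt → <⇒≱ (begin-strict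
      weight g * N + (n G ∸ card {n G} (const false)) ≤⟨ +-monoʳ-≤ (weight g * N) (m∸n≤m (n G) (card {n G} (const false))) ⟩
      weight g * N + n G            <⟨ n<1+n _ ⟩
      suc (weight g * N + n G)      ≡⟨ cong suc (+-comm (weight g * N) (n G)) ⟩
      suc (weight g) * N            ≤⟨ *-monoˡ-≤ N lt ⟩
      weight f * N                  ≤⟨ m≤m+n _ _ ⟩
      weight f * N + (n G ∸ card S) ∎) (least {λ u → g u , false} (colg , Valid-∅))
      where open ≤-Reasoning
    largest : ∀ {g S′} → Minimal g → Valid g S′ → card S′ ≤ card S
    -- Both colourings have minimal weight, so the weights agree and cancel.
    largest {g} {S′} (colg , ming) vg = ≮⇒≥ λ lt → <⇒≱ (∸-monoʳ-< lt (card≤ S′)) (+-cancelˡ-≤ (weight f * N) _ _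
      (subst (λ w → weight f * N + (n G ∸ card S) ≤ w * N + (n G ∸ card S′)) (≤-antisym (ming col) (proj₂ min colg))
        (least {λ u → g u , S′ u} (colg , vg))))

  choosable : ∃ λ f → Colouring f × HasClustering G f 6
  choosable with optimum
  ... | f , S , min , v , largest with alternative min (card S) ≤-refl v
  ...   | c , alt = g , proj₁ g-minimal , clustering
    where open Flexible f S c min v alt largest

-- Rounding, and the bound on the list sizes.

5⌈a/5⌉≥a : ∀ m → m ≤ 5 * ⌈ m /5⌉
5⌈a/5⌉≥a m = +-cancelˡ-≤ 4 m _ (begin
  4 + m                               ≡⟨ +-comm 4 m ⟩
  m + 4                               ≡⟨ m≡m%n+[m/n]*n (m + 4) 5 ⟩
  -- The remainder is at most 4 and cancels against the 4 added for rounding up.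
  (m + 4) % 5 + (m + 4) / 5 * 5       ≤⟨ +-monoˡ-≤ _ (s≤s⁻¹ (m%n<n (m + 4) 5)) ⟩
  4 + (m + 4) / 5 * 5                 ≡⟨ cong (4 +_) (*-comm ((m + 4) / 5) 5) ⟩
  4 + 5 * ⌈ m /5⌉                     ∎)
  where open ≤-Reasoning

theorem10 : (G : Graph) (Δ : ℕ) → MaxDegree≤ G Δ →
    ChoosableWithClustering G ⌈ 2 * (Δ + 1) /5⌉ 6
theorem10 G Δ deg≤Δ L assignment = Colourings.choosable G L (proj₁ ∘ assignment) long
  where
  open ≤-Reasoning
  long : ∀ v → 2 * suc (degree G v) ≤ 5 * length (L v)
  long v = begin
    2 * suc (degree G v)     ≤⟨ *-monoʳ-≤ 2 (s≤s (deg≤Δ v)) ⟩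
    2 * suc Δ                ≡⟨ cong (2 *_) (+-comm 1 Δ) ⟩
    2 * (Δ + 1)              ≤⟨ 5⌈a/5⌉≥a (2 * (Δ + 1)) ⟩
    5 * ⌈ 2 * (Δ + 1) /5⌉    ≤⟨ *-monoʳ-≤ 5 (proj₂ (assignment v)) ⟩
    5 * length (L v)         ∎
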